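{- Let $n\ge3$, let $i$ be an inner vertex ($2\le i\le n-1$), and let $\phi\in\mathcal{F}_n^{\mathbb{Z}}$ be an integer flow for which $\phi'=m_i^+(\phi)$ is defined. The two simplices in $\mathcal{T}_n^{\mathrm{LRL}}$ corresponding to $\phi$ and $\phi'$ are adjacent in $D(\mathcal{T}_n^{\mathrm{LRL}})$ if and only if the sequence of offsets $\mathbf{z}^{(i)}(\phi)$ of $\phi$ at $i$ contains no zeroes.
   Context: The contracted zigzag graph $G_n$ (written $\widehat{\mathrm{Zig}}_n$) is the directed multigraph with vertices $1,\dots,n$ and edges $x_i=(i,i+1)$ for $1\le i\le n-1$ (slack edges), $y_0=(1,2)$, $y_i=(i,i+2)$ for $1\le i\le n-2$, and $y_{n-1}=(n-1,n)$ (nonslack edges). The inner vertices are $2,\dots,n-1$. Each inner vertex $i$ has incoming edges $\{x_{i-1},y_{i-2}\}$ and outgoing edges $\{x_i,y_i\}$. The length-reverse-length (LRL) framing orders them by $y_{i-2}\prec x_{i-1}$ (incoming) and $x_i\prec y_i$ (outgoing) at every inner vertex $i$. A route is a directed path from $1$ to $n$; a prefix at $i$ is a directed path from $1$ to $i$; a suffix at $i$ is a directed path from $i$ to $n$. Paths are sequences of edges (parallel edges are distinguished). For distinct prefixes $P,P'$ at an inner vertex $i$, let $j\le i$ be the vertex after which they coincide and which they enter along different edges $e$ (of $P$) and $e'$ (of $P'$); set $P\prec P'$ if $e\prec e'$ in the incoming order at $j$. For distinct suffixes $Q,Q'$ at $i$, let $k\ge i$ be the first vertex which they leave along different edges $e$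 (of $Q$), $e'$ (of $Q'$); set $Q\prec Q'$ if $e\prec e'$ in the outgoing order at $k$. Two routes $R=PiQ$ and $R'=P'iQ'$ through a common inner vertex $i$ (with prefixes $P,P'$ and suffixes $Q,Q'$ at $i$) conflict at $i$ if the prefixes and suffixes are oppositely ordered ($P\prec P'$ and $Q'\prec Q$, or vice versa). A maximal clique is an inclusion-maximal set of routes no two of which conflict at any vertex. Each route is identified with its 0/1 indicator vector in $\mathbb{R}^{E(G_n)}$, a vertex of the flow polytope of nonnegative unit flows from $1$ to $n$. For a maximal clique $C$, $\Delta_C$ is the convex hull of its routes; the $\Delta_C$ are the maximal simplices of a regular unimodular triangulation of this flow polytope (Danilov–Karzanov–Koshevoy). $\mathcal{T}_n^{\mathrm{LRL}}$ denotes the set of these simplices. Two simplices are adjacent if they share a codimension 1 face, equivalently if their maximal cliques differ by exactly one route. The dual graph $D(\mathcal{T}_n^{\mathrm{LRL}})$ has vertex set $\mathcal{T}_n^{\mathrm{LRL}}$ and an edge between each pair of adjacent simplices. $\mathcal{F}_n^{\mathbb{Z}}$ is the set of functions $\phi:E(G_n)\to\mathbb{Z}_{\ge0}$ with $\sum_{e\text{ into }i}\phi(e)+d_i=\sum_{e\text{ out of }i}\phi(e)$ for every vertex $i$, where $(d_1,\dots,d_n)=(0,1,1,\dots,1,-(n-2))$. There is a bijection (Mészáros–Morales–Striker) $\Delta_C\mapsto\phi(\Delta_C)$ from $\mathcal{T}_n^{\mathrm{LRL}}$ to $\mathcal{F}_n^{\mathbb{Z}}$: $\phi(\Delta_C)(e)=0$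 if $e$ leaves vertex $1$, and if $e$ leaves an inner vertex $i$, then $\phi(\Delta_C)(e)$ is one less than the number of prefixes $P$ at $i$ such that some route of $C$ begins with $P$ followed by $e$. "Corresponding" refers to this bijection. Elementary move $m_i^+$ on $\mathcal{F}_n^{\mathbb{Z}}$, for $2\le i\le n-1$: if $\phi(x_i)>0$ and $\phi(y_{i+1})>0$, then $m_i^+(\phi)$ is the flow obtained by subtracting one from $\phi(x_i)$ and $\phi(y_{i+1})$ and adding one to $\phi(x_{i+2})$ and $\phi(y_i)$; otherwise $m_i^+(\phi)$ is not defined. When $i\in\{n-2,n-1\}$, all conditions and operations involving the nonexistent values $\phi(x_n),\phi(y_n),\phi(x_{n+1})$ are ignored. Sequence of offsets of a flow $\phi\in\mathcal{F}_n^{\mathbb{Z}}$ at $i$, $\mathbf{z}^{(i)}(\phi)=(z_{i+1},\dots,z_{n-1})$, with entries in $\mathbb{Z}\cup\{\varnothing\}$: if $i=n-1$ it is the empty sequence. Otherwise set $z_{i+1}=\phi(y_{i+1})$. As long as some entry is not defined, take the largest index $j$ for which $z_j$ is an already computed integer and: if $z_j<0$, set $z_{j+1}=z_j+\phi(y_{j+1})$; if $z_j>0$, set $z_{j+1}=\varnothing$ and, if $j<n-2$, $z_{j+2}=z_j-\phi(x_{j+2})$; if $z_j=0$, set $z_k=0$ for all $j\le k\le n-1$. -}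

module Defs where

open import Data.Bool.Base using (if_then_else_)
open import Data.Fin.Base using (toℕ)
open import Data.Fin.Properties using (toℕ<n)
open import Data.Integer.Base as ℤ using (ℤ; +_; -[1+_]; 0ℤ; 1ℤ)
open import Data.List.Base using (List; []; _∷_; _++_; allFin; filter; length; map)
open import Data.List.Membership.Propositional using (_∈_; _∉_)
open import Data.List.Relation.Binary.Subset.Propositional using (_⊆_)
open import Data.List.Relation.Unary.Unique.Propositional using (Unique)
open import Data.Maybe.Base using (Maybe; just; nothing)
open import Data.Nat.Base
  using (ℕ; zero; suc; pred; _+_; _∸_; _⊔_; _⊓_; _≤_; _<_; _>_; _≡ᵇ_; s≤s; z<s; s<s)
open import Data.Nat.ListAction using (sum)
open import Data.Nat.Properties
  using (_≟_; ≤-reflexive; ≤-trans; <⇒≤; m≤m+n; m+[n∸m]≡n; +-suc)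
open import Data.Product.Base using (_×_; ∃-syntax; _,_)
open import Data.Sum.Base using (_⊎_)
open import Data.Vec.Base as Vec using (Vec; []; _∷_)
open import Function.Bundles using (_⇔_)
open import Relation.Binary.PropositionalEquality using (_≡_; _≢_; subst)
open import Relation.Nullary using (¬_)

-- The range proofs are irrelevant, so an edge is determined by its kind and
-- its index.  The parallel edges y 0, x 1 (and x (n-1), y (n-1)) are distinct.
data Edge (n : ℕ) : Set where
  x : (i : ℕ) → .(1 ≤ i) → .(i < n) → Edge n
  y : (i : ℕ) → .(i < n) → Edge n

-- For n ≥ 2 the truncations only affect y 0 = (1 , 2) and y (n-1) = (n-1 , n);
-- otherwise y i = (i , i+2).
source target : ∀ {n} → Edge n → ℕ
source (x i _ _) = i
source (y i _)   = 1 ⊔ i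
target (x i _ _) = suc i
target {n} (y i _) = (2 + i) ⊓ n

edges : (n : ℕ) → List (Edge n)
edges zero    = []
edges (suc m) =
  map (λ k → x (suc (toℕ k)) z<s (s<s (toℕ<n k))) (allFin m) ++
  map (λ k → y (toℕ k) (toℕ<n k)) (allFin (suc m))

Inner : ℕ → ℕ → Set
Inner n i = 2 ≤ i × i < n

-- The length-reverse-length framing: the incoming edges of the inner vertex
-- 2 + j are y j ≺ x (1 + j), the outgoing edges of the inner vertex i are
-- x i ≺ y i.
data _≺ⁱⁿ_ {n : ℕ} : Edge n → Edge n → Set where
  y≺x : ∀ j .{p q r} → 2 + j < n → y j p ≺ⁱⁿ x (suc j) q r

data _≺ᵒᵘᵗ_ {n : ℕ} : Edge n → Edge n → Set where
  x≺y : ∀ i .{p q r} → Inner n i → x i p q ≺ᵒᵘᵗ y i r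

EdgeSeq : ℕ → Set
EdgeSeq n = List (Edge n)

IsPath : ∀ {n} → ℕ → EdgeSeq n → ℕ → Set
IsPath i []      j = i ≡ j
IsPath i (e ∷ p) j = source e ≡ i × IsPath (target e) p j

IsRoute : ∀ {n} → EdgeSeq n → Set
IsRoute {n} r = IsPath 1 r n

-- S is the longest common final segment, starting at the vertex that the two
-- prefixes enter along e and e′.
_≺ᵖʳᵉ_ : ∀ {n} → EdgeSeq n → EdgeSeq n → Set
P ≺ᵖʳᵉ P′ = ∃[ A ] ∃[ A′ ] ∃[ e ] ∃[ e′ ] ∃[ S ]
  (P ≡ A ++ e ∷ S × P′ ≡ A′ ++ e′ ∷ S × e ≺ⁱⁿ e′)

_≺ˢᵘᶠ_ : ∀ {n} → EdgeSeq n → EdgeSeq n → Set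
Q ≺ˢᵘᶠ Q′ = ∃[ S ] ∃[ e ] ∃[ e′ ] ∃[ B ] ∃[ B′ ]
  (Q ≡ S ++ e ∷ B × Q′ ≡ S ++ e′ ∷ B′ × e ≺ᵒᵘᵗ e′)

record ConflictAt {n : ℕ} (i : ℕ) (R R′ : EdgeSeq n) : Set where
  field
    P Q P′ Q′ : EdgeSeq n
    R≡PQ      : R ≡ P ++ Q
    R′≡P′Q′   : R′ ≡ P′ ++ Q′
    P-prefix  : IsPath 1 P i
    P′-prefix : IsPath 1 P′ i
    Q-suffix  : IsPath i Q n
    Q′-suffix : IsPath i Q′ n
    opposite  : (P ≺ᵖʳᵉ P′ × Q′ ≺ˢᵘᶠ Q) ⊎ (P′ ≺ᵖʳᵉ P × Q ≺ˢᵘᶠ Q′)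

-- Finite sets of routes are lists used only through membership: order and
-- repetitions play no role in any notion below.
RouteSet : ℕ → Set
RouteSet n = List (EdgeSeq n)

record IsClique {n : ℕ} (C : RouteSet n) : Set where
  field
    routes      : ∀ {R} → R ∈ C → IsRoute R
    no-conflict : ∀ {R R′} → R ∈ C → R′ ∈ C → ∀ {i} → Inner n i → ¬ ConflictAt i R R′

record IsMaximalClique {n : ℕ} (C : RouteSet n) : Set where
  field
    isClique : IsClique C
    maximal  : ∀ D → IsClique D → C ⊆ D → D ⊆ C

-- A maximal simplex Δ_C of the triangulation is represented by its vertex set
-- C.  Two of them share a codimension 1 face when their vertex sets differ by
-- exactly one route: C′ arises from C by replacing R with R′.
Adjacent : ∀ {n} → RouteSet n → RouteSet n → Set
Adjacent C C′ = ∃[ R ] ∃[ R′ ]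
  ( R ∈ C × R ∉ C′ × R′ ∈ C′ × R′ ∉ C
  × (∀ S → S ≢ R → S ≢ R′ → S ∈ C ⇔ S ∈ C′))

Flow : ℕ → Set
Flow n = Edge n → ℕ

inflow outflow : ∀ {n} → Flow n → ℕ → ℕ
inflow  {n} φ v = sum (map φ (filter (λ e → target e ≟ v) (edges n)))
outflow {n} φ v = sum (map φ (filter (λ e → source e ≟ v) (edges n)))

netflow : ℕ → ℕ → ℤ
netflow n v =
  if v ≡ᵇ 1 then 0ℤ else
  if v ≡ᵇ n then ℤ.- (+ (n ∸ 2)) else
  1ℤ

IsIntegerFlow : ∀ {n} → Flow n → Set
IsIntegerFlow {n} φ = ∀ v → 1 ≤ v → v ≤ n →
  (+ inflow φ v) ℤ.+ netflow n v ≡ + outflow φ v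

HasSize : {A : Set} → (A → Set) → ℕ → Set
HasSize P k = ∃[ as ] (Unique as × (∀ a → a ∈ as ⇔ P a) × length as ≡ k)

PrefixBefore : ∀ {n} → RouteSet n → Edge n → EdgeSeq n → Set
PrefixBefore C e P = IsPath 1 P (source e) × ∃[ s ] (P ++ e ∷ s) ∈ C

-- φ = φ(Δ_C): at inner vertices φ e is one less than the number of prefixes,
-- written without truncated subtraction.
record CorrespondsTo {n : ℕ} (C : RouteSet n) (φ : Flow n) : Set where
  field
    at-1  : ∀ e → source e ≡ 1 → φ e ≡ 0
    inner : ∀ e → Inner n (source e) → HasSize (PrefixBefore C e) (suc (φ e))

MoveDefined : ∀ {n} → Flow n → (i : ℕ) → Inner n i → Set
MoveDefined {n} φ i (2≤i , i<n) =
  φ (x i (<⇒≤ 2≤i) i<n) > 0 ×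
  (∀ (1+i<n : suc i < n) → φ (y (suc i) 1+i<n) > 0)

-- Defined edge by edge, so the changes at nonexistent edges drop out.
move : ∀ {n} → ℕ → Flow n → Flow n
move i φ e@(x j _ _) =
  if j ≡ᵇ i     then pred (φ e) else
  if j ≡ᵇ 2 + i then suc (φ e)  else
  φ e
move i φ e@(y j _) =
  if j ≡ᵇ i     then suc (φ e)  else
  if j ≡ᵇ 1 + i then pred (φ e) else
  φ e

private
  shift : ∀ j k {n} → j + suc k < n → suc j + k < n
  shift j k {n} = subst (_< n) (+-suc j k)

  j<n : ∀ {j} k {n} → j + k < n → j < n
  j<n {j} k = ≤-trans (s≤s (m≤m+n j k))

-- Given z_j = z, the offsets z_j , z_{j+1} , … , z_{j+k}, where j + k = n - 1;
-- nothing stands for ∅.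
offsetsFrom : ∀ {n} → Flow n → (k j : ℕ) → .(j + k < n) → ℤ → Vec (Maybe ℤ) (suc k)
offsetsFrom φ zero j _ z = just z ∷ []
offsetsFrom φ (suc k) j b z@(-[1+ _ ]) =
  just z ∷ offsetsFrom φ k (suc j) (shift j k b)
    (z ℤ.+ (+ φ (y (suc j) (j<n k (shift j k b)))))
offsetsFrom φ (suc k) j _ (+ zero) = Vec.replicate (2 + k) (just 0ℤ)
offsetsFrom φ (suc zero) j _ z@(+ suc _) = just z ∷ nothing ∷ []
offsetsFrom φ (suc (suc k)) j b z@(+ suc _) =
  just z ∷ nothing ∷ offsetsFrom φ k (2 + j) (shift (suc j) k (shift j (suc k) b))
    (z ℤ.- (+ φ (x (2 + j) z<s (j<n k (shift (suc j) k (shift j (suc k) b))))))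

-- (z_{i+1} , … , z_{n-1})
offsets : ∀ {n} → Flow n → (i : ℕ) → .(i < n) → Vec (Maybe ℤ) (n ∸ suc i)
offsets {n} φ i i<n = start (n ∸ suc i) (≤-reflexive (m+[n∸m]≡n i<n))
  where
  start : ∀ k → .(i + k < n) → Vec (Maybe ℤ) k
  start zero    _ = []
  start (suc k) b =
    offsetsFrom φ k (suc i) (shift i k b) (+ φ (y (suc i) (j<n k (shift i k b))))

module Submission where

-- The prefixes of a clique C at an inner vertex v form a chain for ≺ᵖʳᵉ, and
-- absence of conflicts puts those followed by x v below those followed by y v.
-- If C corresponds to φ, conservation of flow leaves no freedom: of the
-- φ (x v) + φ (y v) + 1 prefixes at v the first φ (x v) + 1 are followed by x v
-- and the last φ (y v) + 1 by y v, with exactly one in common.  So φ determines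
-- the prefixes at all vertices, and finally C, by a recursion along the vertices.
--
-- Running the recursion for φ and m i φ in parallel, the two chains agree up to
-- i and differ at i + 3 in a single prefix T, replaced in the same position by
-- another one.  At each later vertex j the offset z j is this position minus
-- φ (x j): if z j < 0 the exchanged prefix is followed by x j only, if z j > 0 by
-- y j only, so that a single exchange persists, up to n if no offset vanishes.
-- If z j = 0 then T is followed by both edges and C loses at least two routes.

open import Defs
open import Data.Fin.Base using (Fin; toℕ; fromℕ<)
open import Data.Fin.Properties using (toℕ-injective; toℕ-fromℕ<; toℕ<n)
open import Data.Integer.Base as ℤ using (ℤ; +_; 0ℤ; 1ℤ)
import Data.Integer.Properties as ℤp
open import Data.List.Base
  using (List; []; _∷_; _++_; _∷ʳ_; [_]; filter; length; map; allFin; initLast; _∷ʳ′_)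
open import Data.List.Membership.DecPropositional using (_∈?_)
open import Data.List.Membership.Propositional using (_∈_) renaming (_∉_ to _∉ˡ_)
open import Data.List.Membership.Propositional.Properties
  using (∈-∃++; ∈-++⁻; ∈-++⁺ˡ; ∈-++⁺ʳ; ∈-insert; ∈-map⁺; ∈-map⁻; ∈-filter⁺; ∈-filter⁻; ∈-allFin)
open import Data.List.Properties
  using ( length-++; length-map; length-filter; filter-none; filter-notAll; map-++
        ; ++-assoc; ++-cancelˡ; ++-cancelʳ; ++-identityʳ; ∷-injective; ∷ʳ-injectiveʳ
        ; ∷ʳ-++; ≡-dec )
open import Data.List.Relation.Binary.Permutation.Propositional
  using (_↭_; ↭-sym; ↭-trans; ↭-reflexive; prep)
open import Data.List.Relation.Binary.Permutation.Propositional.Properties using (∈-resp-↭; shift)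
open import Data.List.Relation.Binary.Subset.Propositional using (_⊆_)
open import Data.List.Relation.Unary.All as All using (All; []; _∷_)
import Data.List.Relation.Unary.All.Properties as All
open import Data.List.Relation.Unary.AllPairs as AllPairs using (AllPairs; []; _∷_)
import Data.List.Relation.Unary.AllPairs.Properties as AllPairs
open import Data.List.Relation.Unary.Any using (here; there)
open import Data.List.Relation.Unary.Unique.Propositional using (Unique)
import Data.List.Relation.Unary.Unique.Propositional.Properties as Unique
open import Data.Maybe.Base using (Maybe; just)
open import Data.Nat.Base
  using (ℕ; zero; suc; pred; _+_; _∸_; _≤_; _<_; z≤n; s≤s; z<s; s<s; >-nonZero)
open import Data.Nat.ListAction using (sum)
open import Data.Nat.Properties
open import Data.Product.Base using (_×_; _,_; proj₁; proj₂; ∃-syntax)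
open import Data.Sum.Base using (_⊎_; inj₁; inj₂)
open import Data.Vec.Base using (Vec; []; _∷_)
open import Data.Vec.Membership.Propositional using (_∉_) renaming (_∈_ to _∈ᵛ_)
open import Data.Vec.Relation.Unary.Any using () renaming (here to hereᵛ; there to thereᵛ)
open import Function.Base using (_∘_)
open import Function.Bundles using (_⇔_; mk⇔; Equivalence)
open import Relation.Binary.Definitions using (DecidableEquality)
open import Relation.Binary.PropositionalEquality
  using (_≡_; _≢_; refl; sym; trans; cong; cong₂; subst; module ≡-Reasoning)
open import Relation.Nullary using (¬_; yes; no; contradiction; recompute)
open import Relation.Nullary.Decidable using (dec-true; dec-false)
open import Relation.Unary using (Decidable)

-- Two interleaved subsets of a chain

length-⊆ : {A : Set} {as bs : List A} → Unique as → as ⊆ bs → length as ≤ length bs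
length-⊆ [] _ = z≤n
length-⊆ {as = a ∷ as} (a∉ ∷ u) s with ∈-∃++ (s (here refl))
... | ls , rs , refl = begin
  suc (length as)                ≤⟨ s≤s (length-⊆ u s′) ⟩
  suc (length (ls ++ rs))        ≡⟨ cong suc (length-++ ls) ⟩
  suc (length ls + length rs)    ≡⟨ +-suc (length ls) (length rs) ⟨
  length ls + suc (length rs)    ≡⟨ length-++ ls ⟨
  length (ls ++ a ∷ rs)          ∎
  where
  open ≤-Reasoning
  s′ : as ⊆ ls ++ rs
  s′ m with ∈-++⁻ ls (s (there m))
  ... | inj₁ m′         = ∈-++⁺ˡ m′
  ... | inj₂ (here e)   = contradiction (sym e) (All.lookup a∉ m)
  ... | inj₂ (there m′) = ∈-++⁺ʳ ls m′

module _ {A : Set} where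

  splitAt-length : ∀ a {b} (l : List A) → length l ≡ suc (a + b) →
    ∃[ ls ] ∃[ c ] ∃[ rs ] (l ≡ ls ++ c ∷ rs × length ls ≡ a × length rs ≡ b)
  splitAt-length zero    (c ∷ l) e = [] , c , l , refl , refl , suc-injective e
  splitAt-length (suc a) (d ∷ l) e with splitAt-length a l (suc-injective e)
  ... | ls , c , rs , refl , e₁ , e₂ = d ∷ ls , c , rs , refl , cong suc e₁ , e₂

  length-filter-all : {P : A → Set} (P? : Decidable P) (l : List A) →
    length l ≤ length (filter P? l) → All P l
  length-filter-all P? l le with All.all? P? l
  ... | yes p = p
  ... | no ¬p = contradiction (filter-notAll P? l (All.¬All⇒Any¬ P? l ¬p)) (≤⇒≯ le)

  module _ {P Q : A → Set} (P? : Decidable P) (Q? : Decidable Q) where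

    NoDescent : List A → Set
    NoDescent = AllPairs (λ q p → ¬ (Q q × P p))

    private
      none : ∀ {q l} → Q q → All (λ p → ¬ (Q q × P p)) l → All (¬_ ∘ P) l
      none Qq = All.map (λ ¬QP Pp → ¬QP (Qq , Pp))

    -- Once `Q` holds at an entry, `P` fails at all later ones. So at most one entry satisfies both
    -- and is counted twice.
    filters-bound : ∀ l → NoDescent l →
      length (filter P? l) + length (filter Q? l) ≤ suc (length l)
    filters-bound [] _ = z≤n
    filters-bound (d ∷ l) (h ∷ hs) with P? d | Q? d
    ... | yes _ | no _  = s≤s (filters-bound l hs)
    ... | no _  | no _  = m≤n⇒m≤1+n (filters-bound l hs)
    ... | no _  | yes _ = ≤-trans (≤-reflexive (+-suc _ _)) (s≤s (filters-bound l hs))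
    ... | yes _ | yes Qd rewrite filter-none P? (none Qd h) =
      s≤s (s≤s (length-filter Q? l))

    -- P and Q attain filters-bound, which forces them to be an initial and a
    -- final segment that share c only.
    noDescent-pivot : ∀ ls {c rs} → NoDescent (ls ++ c ∷ rs) →
      length ls < length (filter P? (ls ++ c ∷ rs)) →
      length rs < length (filter Q? (ls ++ c ∷ rs)) →
      (All P (ls ∷ʳ c) × All (¬_ ∘ P) rs) × (All (¬_ ∘ Q) ls × All Q (c ∷ rs))
    noDescent-pivot [] {c} {rs} (h ∷ _) p q with length-filter-all Q? (c ∷ rs) q
    ... | Qs@(Qc ∷ _) with P? c
    ...   | yes Pc = (Pc ∷ [] , none Qc h) , ([] , Qs)
    ...   | no _ rewrite filter-none P? (none Qc h) = contradiction p (<-irrefl refl)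
    noDescent-pivot (d ∷ ls) {c} {rs} (h ∷ hs) p q with P? d | Q? d
    ... | yes Pd | no ¬Qd with noDescent-pivot ls hs (≤-pred p) q
    ...   | (Ps , ¬Ps) , (¬Qs , Qs) = (Pd ∷ Ps , ¬Ps) , (¬Qd ∷ ¬Qs , Qs)
    noDescent-pivot (d ∷ ls) {c} {rs} (h ∷ hs) p q | yes _ | yes Qd
      rewrite filter-none P? (none Qd h) = contradiction (≤-pred p) λ ()
    noDescent-pivot (d ∷ ls) {c} {rs} (h ∷ hs) p q | no _ | yes Qd
      rewrite filter-none P? (none Qd h) = contradiction p λ ()
    -- An entry satisfying neither leaves both lower bounds to the tail, which is too short for them
    -- by `filters-bound`.
    noDescent-pivot (d ∷ ls) {c} {rs} (h ∷ hs) p q | no _ | no _ =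
      contradiction (≤-trans (+-mono-≤ p q) (filters-bound (ls ++ c ∷ rs) hs))
        (<⇒≱ (s≤s (≤-reflexive (cong suc (length-++ ls)))))

-- Edges and conservation of flow

-- Uniqueness bounds the length by 2, so the sum is evaluated whatever the order of the list. This
-- serves inflow and outflow at inner vertices.
sum-map-pair : {A : Set} (f : A → ℕ) {l : List A} {a b : A} → a ≢ b → Unique l →
  (∀ {c} → c ∈ l → c ≡ a ⊎ c ≡ b) → a ∈ l → b ∈ l → sum (map f l) ≡ f a + f b
sum-map-pair f {l} {a} {b} a≢b u only a∈ b∈ = go l u only a∈ b∈ (length-⊆ u l⊆)
  where
  l⊆ : l ⊆ a ∷ b ∷ []
  l⊆ m with only m
  ... | inj₁ refl = here refl
  ... | inj₂ refl = there (here refl)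
  go : ∀ l → Unique l → (∀ {c} → c ∈ l → c ≡ a ⊎ c ≡ b) → a ∈ l → b ∈ l →
    length l ≤ 2 → sum (map f l) ≡ f a + f b
  go (_ ∷ []) _ _ (here refl) (here refl) _ = contradiction refl a≢b
  go (c ∷ d ∷ []) ((c≢d ∷ _) ∷ _) only _ _ _ with only (here refl) | only (there (here refl))
  ... | inj₁ refl | inj₁ refl = contradiction refl c≢d
  ... | inj₁ refl | inj₂ refl = cong (λ k → f a + k) (+-identityʳ (f b))
  ... | inj₂ refl | inj₁ refl =
    trans (cong (λ k → f b + k) (+-identityʳ (f a))) (+-comm (f b) (f a))
  ... | inj₂ refl | inj₂ refl = contradiction refl c≢d
  go (_ ∷ _ ∷ _ ∷ _) _ _ _ _ (s≤s (s≤s ()))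

private
  x-cong : ∀ {n i j} .{p q p′ q′} → i ≡ j → _≡_ {A = Edge n} (x i p q) (x j p′ q′)
  x-cong refl = refl

  y-cong : ∀ {n i j} .{p q} → i ≡ j → _≡_ {A = Edge n} (y i p) (y j q)
  y-cong refl = refl

  index : ∀ {n} → Edge n → ℕ
  index (x i _ _) = i
  index (y i _)   = i

module _ {n : ℕ} where

  infix 4 _≟ₑ_
  _≟ₑ_ : DecidableEquality (Edge n)
  x i _ _ ≟ₑ x j _ _ with i ≟ j
  ... | yes refl = yes refl
  ... | no i≢j   = no λ { refl → i≢j refl }
  y i _ ≟ₑ y j _ with i ≟ j
  ... | yes refl = yes refl
  ... | no i≢j   = no λ { refl → i≢j refl }
  x _ _ _ ≟ₑ y _ _ = no λ ()
  y _ _ ≟ₑ x _ _ _ = no λ ()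

  source-inner : ∀ {t} (e : Edge n) → source e ≡ 2 + t → .(lt : 2 + t < n) →
    e ≡ x (2 + t) z<s lt ⊎ e ≡ y (2 + t) lt
  source-inner (x _ _ _) refl _ = inj₁ refl
  source-inner (y (suc i) _) refl _ = inj₂ refl

  target-y : ∀ {t} .(p : t < n) → 2 + t ≤ n → target (y t p) ≡ 2 + t
  target-y _ = m≤n⇒m⊓n≡m

  target-inner : ∀ {t} (e : Edge n) → target e ≡ 2 + t → (lt : 2 + t < n) →
    e ≡ y t (<⇒≤ (<⇒≤ lt)) ⊎ e ≡ x (suc t) z<s (<⇒≤ lt)
  target-inner (x _ _ _) refl _ = inj₂ refl
  target-inner (y i _) eq lt with ⊓-sel (2 + i) n
  ... | inj₁ e = inj₁ (y-cong (suc-injective (suc-injective (trans (sym e) eq))))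
  ... | inj₂ e = contradiction (trans (sym eq) e) (<⇒≢ lt)

  -- The sink has three incoming edges, since truncation makes `y (n-1)` parallel to `x (n-1)`.
  target-last : ∀ {t} (e : Edge n) → target e ≡ n → (lt : 2 + t < n) → 3 + t ≡ n →
    e ≡ y (1 + t) (<⇒≤ lt) ⊎ e ≡ x (2 + t) z<s lt ⊎ e ≡ y (2 + t) lt
  target-last (x _ _ _) refl lt refl = inj₂ (inj₁ refl)
  target-last {t} (y i p) eq lt refl with i ≟ 1 + t | i ≟ 2 + t
  ... | yes refl | _ = inj₁ refl
  ... | no _ | yes refl = inj₂ (inj₂ refl)
  ... | no ≢1 | no ≢2 = contradiction 3+t≤2+i (<⇒≱ (s≤s (s≤s (≤∧≢⇒< (≤-pred i<2+t) ≢1))))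
    where
    3+t≤2+i : 3 + t ≤ 2 + i
    3+t≤2+i = m⊓n≡n⇒n≤m eq
    i<2+t : i < 2 + t
    i<2+t = ≤∧≢⇒< (≤-pred (recompute (_ <? _) p)) ≢2

  source<target : 1 < n → (e : Edge n) → source e < target e
  source<target 1<n (x i _ _) = ≤-refl
  source<target 1<n (y i p) = ⊓-glb
    (⊔-pres-<m (s≤s (s≤s z≤n)) (m<n+m i z<s))
    (⊔-pres-<m 1<n (recompute (_ <? _) p))

private
  xᵉ : ∀ {m} → Fin m → Edge (suc m)
  xᵉ k = x (suc (toℕ k)) z<s (s<s (toℕ<n k))

  yᵉ : ∀ {m} → Fin m → Edge m
  yᵉ k = y (toℕ k) (toℕ<n k)

∈-edges : ∀ {n} (e : Edge n) → e ∈ edges n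
∈-edges {suc m} (x (suc i) _ q) = ∈-++⁺ˡ (subst (_∈ map xᵉ (allFin m))
  (x-cong (cong suc (toℕ-fromℕ< i<m))) (∈-map⁺ xᵉ (∈-allFin (fromℕ< i<m))))
  where
  i<m : i < m
  i<m = ≤-pred (recompute (_ <? _) q)
∈-edges {suc m} (y i p) = ∈-++⁺ʳ (map xᵉ (allFin m)) (subst (_∈ map yᵉ (allFin (suc m)))
  (y-cong (toℕ-fromℕ< i<n)) (∈-map⁺ yᵉ (∈-allFin (fromℕ< i<n))))
  where
  i<n : i < suc m
  i<n = recompute (_ <? _) p

edges-unique : ∀ n → Unique (edges n)
edges-unique zero = []
edges-unique (suc m) = Unique.++⁺
  (Unique.map⁺ (λ e → toℕ-injective (suc-injective (cong index e))) (Unique.allFin⁺ m))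
  (Unique.map⁺ (λ e → toℕ-injective (cong index e)) (Unique.allFin⁺ (suc m)))
  λ (p , q) → disjoint (∈-map⁻ xᵉ p) (∈-map⁻ yᵉ q)
  where
  disjoint : ∀ {e : Edge (suc m)} →
    ∃[ k ] (k ∈ allFin m × e ≡ xᵉ k) → ¬ (∃[ k ] (k ∈ allFin (suc m) × e ≡ yᵉ k))
  disjoint (_ , _ , refl) (_ , _ , ())

sum-filter-pair : ∀ {n} (φ : Flow n) {P : Edge n → Set} (P? : Decidable P) {e e′ : Edge n} →
  e ≢ e′ → P e → P e′ → (∀ f → P f → f ≡ e ⊎ f ≡ e′) →
  sum (map φ (filter P? (edges n))) ≡ φ e + φ e′
sum-filter-pair {n} φ P? e≢e′ Pe Pe′ only = sum-map-pair φ e≢e′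
  (Unique.filter⁺ P? (edges-unique n))
  (λ m → only _ (proj₂ (∈-filter⁻ P? {xs = edges n} m)))
  (∈-filter⁺ P? (∈-edges _) Pe) (∈-filter⁺ P? (∈-edges _) Pe′)

-- The `suc` is the unit netflow of an inner vertex. It keeps the number of prefixes at each inner
-- vertex equal to the outflow plus one.
conservation : ∀ {n} {φ : Flow n} → IsIntegerFlow φ → ∀ {t} (lt : 2 + t < n) →
  suc (φ (y t (<⇒≤ (<⇒≤ lt))) + φ (x (suc t) z<s (<⇒≤ lt))) ≡ φ (x (2 + t) z<s lt) + φ (y (2 + t) lt)
conservation {n} {φ} flow {t} lt = begin
  suc (φ (y t _) + φ (x (suc t) _ _))        ≡⟨ cong suc in≡ ⟨
  suc (inflow φ (2 + t))                     ≡⟨ +-comm 1 _ ⟩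
  inflow φ (2 + t) + 1                       ≡⟨ ℤp.+-injective in+1≡out ⟩
  outflow φ (2 + t)                          ≡⟨ out≡ ⟩
  φ (x (2 + t) _ _) + φ (y (2 + t) _)        ∎
  where
  open ≡-Reasoning
  in≡ : inflow φ (2 + t) ≡ φ (y t (<⇒≤ (<⇒≤ lt))) + φ (x (suc t) z<s (<⇒≤ lt))
  in≡ = sum-filter-pair φ (λ e → target e ≟ 2 + t) (λ ()) (target-y (<⇒≤ (<⇒≤ lt)) (<⇒≤ lt)) refl
    (λ e eq → target-inner e eq lt)
  out≡ : outflow φ (2 + t) ≡ φ (x (2 + t) z<s lt) + φ (y (2 + t) lt)
  out≡ = sum-filter-pair φ (λ e → source e ≟ 2 + t) (λ ()) refl refl
    (λ e eq → source-inner e eq lt)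
  net : netflow n (2 + t) ≡ 1ℤ
  net rewrite dec-false (2 + t ≟ n) (<⇒≢ lt) = refl
  in+1≡out : + inflow φ (2 + t) ℤ.+ 1ℤ ≡ + outflow φ (2 + t)
  in+1≡out = trans (cong (λ d → + inflow φ (2 + t) ℤ.+ d) (sym net)) (flow (2 + t) z<s (<⇒≤ lt))

-- The prefixes of a clique

IsPath-++⁻ : ∀ {n i j} (P : EdgeSeq n) {Q} → IsPath i (P ++ Q) j → ∃[ m ] (IsPath i P m × IsPath m Q j)
IsPath-++⁻ []      q = _ , refl , q
IsPath-++⁻ (e ∷ P) (s , q) with IsPath-++⁻ P q
... | m , p , q′ = m , (s , p) , q′

IsPath-end : ∀ {n i j k} (P : EdgeSeq n) → IsPath i P j → IsPath i P k → j ≡ k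
IsPath-end []      p q = trans (sym p) q
IsPath-end (_ ∷ P) (_ , p) (_ , q) = IsPath-end P p q

IsPath-++⁺ : ∀ {n i j k} (P : EdgeSeq n) {Q} → IsPath i P j → IsPath j Q k → IsPath i (P ++ Q) k
IsPath-++⁺ []      refl q = q
IsPath-++⁺ (_ ∷ P) (s , p) q = s , IsPath-++⁺ P p q

IsPath-dropPrefix : ∀ {n i j k} (P : EdgeSeq n) {Q} →
  IsPath i P j → IsPath i (P ++ Q) k → IsPath j Q k
IsPath-dropPrefix P p pq with IsPath-++⁻ P pq
... | _ , p′ , q = subst (λ m → IsPath m _ _) (IsPath-end P p′ p) q

IsPath-≤ : ∀ {n i j} → 1 < n → (P : EdgeSeq n) → IsPath i P j → i ≤ j
IsPath-≤ 1<n [] refl = ≤-refl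
IsPath-≤ 1<n (e ∷ P) (refl , p) = ≤-trans (<⇒≤ (source<target 1<n e)) (IsPath-≤ 1<n P p)

IsPath-closed : ∀ {n i} → 1 < n → (P : EdgeSeq n) → IsPath i P i → P ≡ []
IsPath-closed 1<n [] _ = refl
IsPath-closed 1<n (e ∷ P) (refl , p) =
  contradiction (IsPath-≤ 1<n P p) (<⇒≱ (source<target 1<n e))

AllPairs-++⁻ : {A : Set} {R : A → A → Set} (as : List A) {bs : List A} →
  AllPairs R (as ++ bs) → AllPairs R as × AllPairs R bs
AllPairs-++⁻ []       ps       = [] , ps
AllPairs-++⁻ (a ∷ as) (p ∷ ps) with AllPairs-++⁻ as ps
... | l , r = All.++⁻ˡ as p ∷ l , r

-- Cancelling the common end forces `e` and `e′` to be equal, but the framing compares a `y` with an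
-- `x`.
≺ᵖʳᵉ-irrefl : ∀ {n} {P : EdgeSeq n} → ¬ P ≺ᵖʳᵉ P
≺ᵖʳᵉ-irrefl (A , A′ , e , e′ , S , refl , eq , e≺e′)
  with ∷ʳ-injectiveʳ A A′ (++-cancelʳ S (A ∷ʳ e) (A′ ∷ʳ e′)
    (trans (∷ʳ-++ A e S) (trans eq (sym (∷ʳ-++ A′ e′ S)))))
≺ᵖʳᵉ-irrefl (_ , _ , _ , _ , _ , _ , _ , y≺x _ _) | ()

≺ᵖʳᵉ-∷ʳ : ∀ {n} {P P′ : EdgeSeq n} f → P ≺ᵖʳᵉ P′ → (P ∷ʳ f) ≺ᵖʳᵉ (P′ ∷ʳ f)
≺ᵖʳᵉ-∷ʳ f (A , A′ , e , e′ , S , refl , refl , e≺e′) =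
  A , A′ , e , e′ , S ∷ʳ f , ++-assoc A (e ∷ S) [ f ] , ++-assoc A′ (e′ ∷ S) [ f ] , e≺e′

Sorted : ∀ {n} → List (EdgeSeq n) → Set
Sorted = AllPairs _≺ᵖʳᵉ_

-- Prefixes with the same last edge keep their order. Those with different last edges are compared
-- at their end, where `y t` precedes `x (suc t)`.
Sorted-extend : ∀ {n t K L} .{p q r} → 2 + t < n → Sorted K → Sorted L →
  Sorted {n} (map (_∷ʳ y t p) K ++ map (_∷ʳ x (suc t) q r) L)
Sorted-extend {t = t} {p = p} {q} {r} lt k l = AllPairs.++⁺
  (AllPairs.map⁺ (AllPairs.map (≺ᵖʳᵉ-∷ʳ (y t p)) k))
  (AllPairs.map⁺ (AllPairs.map (≺ᵖʳᵉ-∷ʳ (x (suc t) q r)) l))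
  (All.map⁺ (All.universal (λ P → All.map⁺ (All.universal
    (λ P′ → P , P′ , y t p , x (suc t) q r , [] , refl , refl , y≺x t lt) _)) _))

Pre : ∀ {n} → RouteSet n → ℕ → EdgeSeq n → Set
Pre C v P = IsPath 1 P v × ∃[ s ] (P ++ s) ∈ C

module _ {n : ℕ} {C : RouteSet n} where

  before⇒pre : ∀ {e P} → PrefixBefore C e P → Pre C (source e) P
  before⇒pre (p , s , m) = p , _ , m

  before⇒pre-∷ʳ : ∀ {e P} → PrefixBefore C e P → Pre C (target e) (P ∷ʳ e)
  before⇒pre-∷ʳ {e} {P} (p , s , m) =
    IsPath-++⁺ P p (refl , refl) , s , subst (_∈ C) (sym (∷ʳ-++ P e s)) m

  pre-∷ʳ⇒before : ∀ {e P v} → Pre C v (P ∷ʳ e) → PrefixBefore C e P × target e ≡ v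
  pre-∷ʳ⇒before {e} {P} (p , s , m) with IsPath-++⁻ P p
  ... | _ , p′ , refl , t = (p′ , s , subst (_∈ C) (∷ʳ-++ P e s) m) , t

  module _ (clique : IsClique C) where
    open IsClique clique

    -- The suffixes already part at `2 + t`, in the order `x` before `y`, so prefixes in the
    -- opposite order would create a conflict there.
    before-noDescent : ∀ {t P P′} (lt : 2 + t < n) →
      PrefixBefore C (x (2 + t) z<s lt) P → PrefixBefore C (y (2 + t) lt) P′ → ¬ P′ ≺ᵖʳᵉ P
    before-noDescent {t} {P} {P′} lt (p , s , m) (p′ , s′ , m′) P′≺P =
      no-conflict m′ m (s≤s (s≤s z≤n) , lt) record
        { P = P′ ; P′ = P ; R≡PQ = refl ; R′≡P′Q′ = refl
        ; P-prefix = p′ ; P′-prefix = p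
        ; Q-suffix = IsPath-dropPrefix P′ p′ (routes m′)
        ; Q′-suffix = IsPath-dropPrefix P p (routes m)
        ; opposite = inj₁ (P′≺P , [] , _ , _ , _ , _ , refl , refl , x≺y (2 + t) (s≤s (s≤s z≤n) , lt))
        }

    ∈⇒pre-end : ∀ {R} → R ∈ C → Pre C n R
    ∈⇒pre-end m = routes m , [] , subst (_∈ C) (sym (++-identityʳ _)) m

    pre-end⇒∈ : ∀ {R} → 1 < n → Pre C n R → R ∈ C
    pre-end⇒∈ {R} 1<n (p , s , m) with IsPath-closed 1<n s (IsPath-dropPrefix R p (routes m))
    ... | refl = subst (_∈ C) (++-identityʳ _) m

-- Splitting the prefixes at a vertex, and the recursion along the vertices.

HasSize-filter : {A : Set} (_≟_ : DecidableEquality A) {P : A → Set} {k : ℕ} {l : List A} →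
  ((as , _) : HasSize P k) → (∀ {a} → P a → a ∈ l) →
  k ≤ length (filter (λ a → _∈?_ _≟_ a as) l)
HasSize-filter _≟_ (as , u , as⇔ , refl) P⊆l =
  length-⊆ u (λ {a} m → ∈-filter⁺ (λ a → _∈?_ _≟_ a as) (P⊆l (Equivalence.to (as⇔ a) m)) m)

-- The recursion at v = 2 + t: K lists the prefixes followed by y (v-1), and L
-- those at v.  That all listed prefixes do occur follows from the next split,
-- except that K is needed at v = n-1 (at n = 3 this uses maximality).
record State {n} (C : RouteSet n) (t : ℕ) .(lt : 2 + t < n) (K L : List (EdgeSeq n)) : Set where
  field
    K-sorted   : Sorted K
    K-complete : ∀ {P} → PrefixBefore C (y (1 + t) (<⇒≤ lt)) P → P ∈ K
    K-sound    : 3 + t ≡ n → ∀ {P} → P ∈ K → PrefixBefore C (y (1 + t) (<⇒≤ lt)) P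
    L-sorted   : Sorted L
    L-complete : ∀ {P} → Pre C (2 + t) P → P ∈ L

Counts : ∀ {n} → RouteSet n → Flow n → Set
Counts {n} C φ = ∀ e → Inner n (source e) → HasSize (PrefixBefore C e) (suc (φ e))

_≟ₛ_ : ∀ {n} → DecidableEquality (EdgeSeq n)
_≟ₛ_ = ≡-dec _≟ₑ_

module _ {n : ℕ} {C : RouteSet n} (clique : IsClique C) {φ : Flow n} (counts : Counts C φ)
  {t : ℕ} (lt : 2 + t < n) {K A B : List (EdgeSeq n)} {c : EdgeSeq n}
  (state : State C t lt K (A ++ c ∷ B))
  (|A| : length A ≡ φ (x (2 + t) z<s lt)) (|B| : length B ≡ φ (y (2 + t) lt)) where

  open State state
  private
    e₁ e₂ : Edge n
    e₁ = x (2 + t) z<s lt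
    e₂ = y (2 + t) lt
    l : List (EdgeSeq n)
    l = A ++ c ∷ B
    inner : Inner n (2 + t)
    inner = s≤s (s≤s z≤n) , lt
    size₁ = counts e₁ inner
    size₂ = counts e₂ inner
    -- Membership in the enumeration given by `counts` decides which prefixes are followed by the
    -- edge.
    in₁? = λ a → _∈?_ _≟ₛ_ a (proj₁ size₁)
    in₂? = λ a → _∈?_ _≟ₛ_ a (proj₁ size₂)
    in₁⇔ = proj₁ (proj₂ (proj₂ size₁))
    in₂⇔ = proj₁ (proj₂ (proj₂ size₂))

    -- The clique condition excludes descents, and the cardinalities `suc (φ e)` exceed `length A`
    -- and `length B` by one, as the pivot requires.
    split = noDescent-pivot in₁? in₂? A
      (AllPairs.map (λ q≺p (q , p) → before-noDescent clique lt
        (Equivalence.to (in₁⇔ _) p) (Equivalence.to (in₂⇔ _) q) q≺p) L-sorted)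
      (subst (_< length (filter in₁? l)) (sym |A|) (HasSize-filter _≟ₛ_ size₁ (L-complete ∘ before⇒pre)))
      (subst (_< length (filter in₂? l)) (sym |B|) (HasSize-filter _≟ₛ_ size₂ (L-complete ∘ before⇒pre)))

  before-x : ∀ {P} → PrefixBefore C (x (2 + t) z<s lt) P ⇔ P ∈ A ∷ʳ c
  before-x {P} = mk⇔ to (λ m → Equivalence.to (in₁⇔ _) (All.lookup (proj₁ (proj₁ split)) m))
    where
    to : PrefixBefore C e₁ P → P ∈ A ∷ʳ c
    to b with ∈-++⁻ (A ∷ʳ c) (subst (P ∈_) (sym (∷ʳ-++ A c B)) (L-complete (before⇒pre b)))
    ... | inj₁ m = m
    ... | inj₂ m = contradiction (Equivalence.from (in₁⇔ _) b) (All.lookup (proj₂ (proj₁ split)) m)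

  before-y : ∀ {P} → PrefixBefore C (y (2 + t) lt) P ⇔ P ∈ c ∷ B
  before-y {P} = mk⇔ to (λ m → Equivalence.to (in₂⇔ _) (All.lookup (proj₂ (proj₂ split)) m))
    where
    to : PrefixBefore C e₂ P → P ∈ c ∷ B
    to b with ∈-++⁻ A (L-complete (before⇒pre b))
    ... | inj₁ m = contradiction (Equivalence.from (in₂⇔ _) b) (All.lookup (proj₁ (proj₂ split)) m)
    ... | inj₂ m = m

  step-K step-X step-Y : List (EdgeSeq n)
  step-K = map (_∷ʳ y (1 + t) (<⇒≤ lt)) K
  step-X = map (_∷ʳ x (2 + t) z<s lt) (A ∷ʳ c)
  step-Y = map (_∷ʳ y (2 + t) lt) (c ∷ B)

  -- The edge `y (2 + t)` skips `3 + t`, so `c ∷ B` waits as the next `K`. The prefixes at `3 + t`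
  -- arrive by `y (1 + t)` from `K` or by `x (2 + t)` from `A ∷ʳ c`, in this order by the framing.
  advance : (lt′ : 3 + t < n) → State C (suc t) lt′ (c ∷ B) (step-K ++ step-X)
  advance lt′ = record
    { K-sorted   = proj₂ (AllPairs-++⁻ A L-sorted)
    ; K-complete = Equivalence.to before-y
    ; K-sound    = λ _ → Equivalence.from before-y
    ; L-sorted   = Sorted-extend lt′ K-sorted
        (proj₁ (AllPairs-++⁻ (A ∷ʳ c) (subst Sorted (sym (∷ʳ-++ A c B)) L-sorted)))
    ; L-complete = complete
    }
    where
    complete : ∀ {P} → Pre C (3 + t) P → P ∈ step-K ++ step-X
    complete {P} p with initLast P
    complete (() , _) | []
    complete p | P ∷ʳ′ e with pre-∷ʳ⇒before p
    ... | b , eq with target-inner e eq lt′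
    ...   | inj₁ refl = ∈-++⁺ˡ (∈-map⁺ (_∷ʳ _) (K-complete b))
    ...   | inj₂ refl = ∈-++⁺ʳ step-K (∈-map⁺ (_∷ʳ _) (Equivalence.to before-x b))

  -- All three incoming edges of the sink contribute. The paths through `K` occur by `K-sound`, the
  -- others by the split.
  finish : 3 + t ≡ n → ∀ {R} → R ∈ C ⇔ R ∈ step-K ++ step-X ++ step-Y
  finish end {R} = mk⇔ (to ∘ ∈⇒pre-end clique) from
    where
    1<n : 1 < n
    1<n = ≤-trans (s≤s (s≤s z≤n)) lt
    to : ∀ {R} → Pre C n R → R ∈ step-K ++ step-X ++ step-Y
    to {R} p with initLast R
    to (refl , _) | [] = contradiction 1<n (<-irrefl refl)
    to p | P ∷ʳ′ e with pre-∷ʳ⇒before p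
    ... | b , eq with target-last e eq lt end
    ...   | inj₁ refl        = ∈-++⁺ˡ (∈-map⁺ (_∷ʳ _) (K-complete b))
    ...   | inj₂ (inj₁ refl) = ∈-++⁺ʳ step-K (∈-++⁺ˡ (∈-map⁺ (_∷ʳ _) (Equivalence.to before-x b)))
    ...   | inj₂ (inj₂ refl) = ∈-++⁺ʳ step-K (∈-++⁺ʳ step-X (∈-map⁺ (_∷ʳ _) (Equivalence.to before-y b)))
    last : ∀ {e P} → PrefixBefore C e P → target e ≡ n → (P ∷ʳ e) ∈ C
    last {e} {P} b eq = pre-end⇒∈ clique 1<n (subst (λ v → Pre C v (P ∷ʳ e)) eq (before⇒pre-∷ʳ b))
    from : R ∈ step-K ++ step-X ++ step-Y → R ∈ C
    from m with ∈-++⁻ step-K m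
    ... | inj₁ m₁ with ∈-map⁻ _ m₁
    ...   | _ , k , refl = last (K-sound end k) (m≥n⇒m⊓n≡n (≤-reflexive (sym end)))
    from m | inj₂ m₂ with ∈-++⁻ step-X m₂
    ... | inj₁ m₃ with ∈-map⁻ _ m₃
    ...   | _ , k , refl = last (Equivalence.from before-x k) end
    from m | inj₂ m₂ | inj₂ m₃ with ∈-map⁻ _ m₃
    ...   | _ , k , refl = last (Equivalence.from before-y k)
      (m≥n⇒m⊓n≡n (≤-trans (≤-reflexive (sym end)) (n≤1+n _)))

-- The start of the recursion at vertex 2.

module _ {n : ℕ} (lt : 2 < n) {C : RouteSet n} (maximal : IsMaximalClique C) where
  open IsMaximalClique maximal renaming (maximal to C-maximal)
  open IsClique isClique

  private
    1<n : 1 < n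
    1<n = <⇒≤ lt

    direct : Edge n
    direct = y 1 1<n

  -- For `n = 3` the edge `y 1` is a route that meets no inner vertex. It conflicts with nothing, so
  -- maximality puts it into `C`.
  direct∈ : 3 ≡ n → [ direct ] ∈ C
  direct∈ refl = C-maximal ([ direct ] ∷ C) clique there (here refl)
    where
    not-through : ∀ {i} P {Q} → Inner 3 i → [ direct ] ≡ P ++ Q → ¬ IsPath 1 P i
    not-through [] (s≤s () , _) _ refl
    not-through (_ ∷ []) (_ , s≤s (s≤s (s≤s ()))) refl (_ , refl)
    not-through (_ ∷ _ ∷ _) _ ()
    clique : IsClique ([ direct ] ∷ C)
    clique .IsClique.routes (here refl) = refl , refl
    clique .IsClique.routes (there m) = routes m
    clique .IsClique.no-conflict (here refl) _ inner c =
      not-through (ConflictAt.P c) inner (ConflictAt.R≡PQ c) (ConflictAt.P-prefix c)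
    clique .IsClique.no-conflict (there _) (here refl) inner c =
      not-through (ConflictAt.P′ c) inner (ConflictAt.R′≡P′Q′ c) (ConflictAt.P′-prefix c)
    clique .IsClique.no-conflict (there m) (there m′) = no-conflict m m′

  initial : State C 0 lt [ [] ] ([ y 0 (<⇒≤ 1<n) ] ∷ [ x 1 z<s 1<n ] ∷ [])
  initial = record
    { K-sorted   = [] ∷ []
    ; K-complete = λ (p , _) → here (IsPath-closed 1<n _ p)
    ; K-sound    = λ { end (here refl) → refl , [] , direct∈ end }
    ; L-sorted   = (([] , [] , _ , _ , [] , refl , refl , y≺x 0 lt) ∷ []) ∷ [] ∷ []
    ; L-complete = complete
    }
    where
    complete : ∀ {P} → Pre C 2 P → P ∈ [ y 0 (<⇒≤ 1<n) ] ∷ [ x 1 z<s 1<n ] ∷ []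
    complete {P} p with initLast P
    complete (() , _) | []
    complete p | P ∷ʳ′ e with pre-∷ʳ⇒before p
    ... | (p′ , _) , eq with target-inner e eq lt
    ...   | inj₁ refl = here (cong (_∷ʳ e) (IsPath-closed 1<n P p′))
    ...   | inj₂ refl = there (here (cong (_∷ʳ e) (IsPath-closed 1<n P p′)))

-- Comparison of two cliques

module _ {n : ℕ} {C C′ : RouteSet n} where

  -- Only membership matters, so both listings may be permuted until the exchanged routes precede a
  -- common remainder `D`.
  adjacent-replace : ∀ {l l′ D T T′} → (∀ {R} → R ∈ C ⇔ R ∈ l) → (∀ {R} → R ∈ C′ ⇔ R ∈ l′) →
    l ↭ T ∷ D → l′ ↭ T′ ∷ D → T ∉ˡ C′ → T′ ∉ˡ C → Adjacent C C′
  adjacent-replace {D = D} {T} {T′} C⇔ C′⇔ σ σ′ T∉ T′∉ =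
    T , T′ , from C⇔ (∈-resp-↭ (↭-sym σ) (here refl)) , T∉
      , from C′⇔ (∈-resp-↭ (↭-sym σ′) (here refl)) , T′∉
      , λ S S≢T S≢T′ → mk⇔ (λ m → replace C′⇔ σ′ (rest S≢T (∈-resp-↭ σ (to C⇔ m))))
                            (λ m → replace C⇔ σ (rest S≢T′ (∈-resp-↭ σ′ (to C′⇔ m))))
    where
    open Equivalence
    rest : ∀ {S U} → S ≢ U → S ∈ U ∷ D → S ∈ D
    rest S≢U (here e)  = contradiction e S≢U
    rest S≢U (there m) = m
    replace : ∀ {B m U S} → (∀ {R} → R ∈ B ⇔ R ∈ m) → m ↭ U ∷ D → S ∈ D → S ∈ B
    replace B⇔ τ s = from B⇔ (∈-resp-↭ (↭-sym τ) (there s))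

  -- Adjacency transports every route of `C` other than `R` to `C′`, so any lost route equals `R`.
  two-lost⇒¬adjacent : ∀ {R₁ R₂} → R₁ ≢ R₂ → R₁ ∈ C → R₁ ∉ˡ C′ → R₂ ∈ C → R₂ ∉ˡ C′ → ¬ Adjacent C C′
  two-lost⇒¬adjacent R₁≢R₂ m₁ ∉₁ m₂ ∉₂ (R , R′ , _ , _ , _ , R′∉C , same) =
    only m₁ ∉₁ λ { refl → only m₂ ∉₂ λ { refl → R₁≢R₂ refl } }
    where
    only : ∀ {S} → S ∈ C → S ∉ˡ C′ → ¬ ¬ (S ≡ R)
    only {S} m ∉ˡ S≢R = ∉ˡ (Equivalence.to (same S S≢R λ { refl → R′∉C m }) m)

-- Lengths and rearrangements of the lists produced by a step.

module _ {A B : Set} where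

  map-++∷ : (f : A → B) (L : List A) {T : A} {M : List A} →
    map f (L ++ T ∷ M) ≡ map f L ++ f T ∷ map f M
  map-++∷ f L = map-++ f L _

  length-step : ∀ (f g : A → B) {a b} K A₀ {c : A} → length K ≡ suc a → length A₀ ≡ b →
    length (map f K ++ map g (A₀ ∷ʳ c)) ≡ suc (suc (a + b))
  length-step f g {a} {b} K A₀ {c} |K| |A| = begin
    length (map f K ++ map g (A₀ ∷ʳ c))         ≡⟨ length-++ (map f K) ⟩
    length (map f K) + length (map g (A₀ ∷ʳ c)) ≡⟨ cong₂ _+_ (length-map f K) (length-map g (A₀ ∷ʳ c)) ⟩
    length K + length (A₀ ∷ʳ c)                 ≡⟨ cong₂ _+_ |K| |Ac| ⟩
    suc a + suc b                               ≡⟨ cong suc (+-suc a b) ⟩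
    suc (suc (a + b))                           ∎
    where
    open ≡-Reasoning
    |Ac| : length (A₀ ∷ʳ c) ≡ suc b
    |Ac| = trans (length-++ A₀) (trans (+-comm (length A₀) 1) (cong suc |A|))

  step-x-shape : ∀ (f g : A → B) K L {T} E {c : A} →
    map f K ++ map g ((L ++ T ∷ E) ∷ʳ c) ≡ (map f K ++ map g L) ++ g T ∷ map g (E ∷ʳ c)
  step-x-shape f g K L {T} E {c} = begin
    map f K ++ map g ((L ++ T ∷ E) ∷ʳ c)          ≡⟨ cong (λ l → map f K ++ map g l) (++-assoc L (T ∷ E) [ c ]) ⟩
    map f K ++ map g (L ++ T ∷ E ∷ʳ c)            ≡⟨ cong (map f K ++_) (map-++∷ g L) ⟩
    map f K ++ map g L ++ g T ∷ map g (E ∷ʳ c)    ≡⟨ ++-assoc (map f K) _ _ ⟨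
    (map f K ++ map g L) ++ g T ∷ map g (E ∷ʳ c)  ∎
    where open ≡-Reasoning

  step-y-shape : ∀ (f : A → B) L {T M} {N : List B} →
    map f (L ++ T ∷ M) ++ N ≡ map f L ++ f T ∷ (map f M ++ N)
  step-y-shape f L {T} {M} {N} = trans (cong (_++ N) (map-++∷ f L)) (++-assoc (map f L) _ N)

  step-x-↭ : ∀ (f g : A → B) K L {T} E {c : A} {Y} →
    map f K ++ map g ((L ++ T ∷ E) ∷ʳ c) ++ Y ↭ g T ∷ ((map f K ++ map g L) ++ map g (E ∷ʳ c) ++ Y)
  step-x-↭ f g K L {T} E {c} {Y} = ↭-trans (↭-reflexive (begin
    map f K ++ map g ((L ++ T ∷ E) ∷ʳ c) ++ Y            ≡⟨ ++-assoc (map f K) _ Y ⟨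
    (map f K ++ map g ((L ++ T ∷ E) ∷ʳ c)) ++ Y          ≡⟨ cong (_++ Y) (step-x-shape f g K L E) ⟩
    ((map f K ++ map g L) ++ g T ∷ map g (E ∷ʳ c)) ++ Y  ≡⟨ ++-assoc (map f K ++ map g L) _ Y ⟩
    (map f K ++ map g L) ++ g T ∷ map g (E ∷ʳ c) ++ Y    ∎))
    (shift (g T) (map f K ++ map g L) _)
    where open ≡-Reasoning

  step-y-↭ : ∀ (h : A → B) (X₀ X : List B) E {T} M →
    X₀ ++ X ++ map h (E ++ T ∷ M) ↭ h T ∷ (((X₀ ++ X) ++ map h E) ++ map h M)
  step-y-↭ h X₀ X E {T} M = ↭-trans (↭-reflexive (begin
    X₀ ++ X ++ map h (E ++ T ∷ M)               ≡⟨ ++-assoc X₀ X _ ⟨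
    (X₀ ++ X) ++ map h (E ++ T ∷ M)             ≡⟨ cong ((X₀ ++ X) ++_) (map-++∷ h E) ⟩
    (X₀ ++ X) ++ map h E ++ h T ∷ map h M       ≡⟨ ++-assoc (X₀ ++ X) (map h E) _ ⟨
    ((X₀ ++ X) ++ map h E) ++ h T ∷ map h M     ∎))
    (shift (h T) ((X₀ ++ X) ++ map h E) (map h M))
    where open ≡-Reasoning

  step-x-last-↭ : ∀ (g : A → B) X₀ L {c : A} {Y} →
    X₀ ++ map g (L ∷ʳ c) ++ Y ↭ g c ∷ ((X₀ ++ map g L) ++ Y)
  step-x-last-↭ g X₀ L {c} {Y} = ↭-trans (↭-reflexive (begin
    X₀ ++ map g (L ∷ʳ c) ++ Y        ≡⟨ cong (λ l → X₀ ++ l ++ Y) (map-++ g L [ c ]) ⟩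
    X₀ ++ (map g L ∷ʳ g c) ++ Y      ≡⟨ cong (X₀ ++_) (∷ʳ-++ (map g L) (g c) Y) ⟩
    X₀ ++ map g L ++ g c ∷ Y         ≡⟨ ++-assoc X₀ (map g L) _ ⟨
    (X₀ ++ map g L) ++ g c ∷ Y       ∎))
    (shift (g c) (X₀ ++ map g L) Y)
    where open ≡-Reasoning

-- Positions in sorted lists and the arithmetic of offsets.

sorted⇒∉ˡ : ∀ {n} (A : List (EdgeSeq n)) {P B} → Sorted (A ++ P ∷ B) → P ∉ˡ A
sorted⇒∉ˡ (_ ∷ A) (h ∷ _) (here refl) = ≺ᵖʳᵉ-irrefl (All.lookup h (∈-insert A))
sorted⇒∉ˡ (_ ∷ A) (_ ∷ s) (there m)   = sorted⇒∉ˡ A s m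

sorted⇒∉ʳ : ∀ {n} (A : List (EdgeSeq n)) {P B} → Sorted (A ++ P ∷ B) → P ∉ˡ B
sorted⇒∉ʳ A s m with AllPairs-++⁻ A s
... | _ , h ∷ _ = ≺ᵖʳᵉ-irrefl (All.lookup h m)

pivot-length : ∀ {A : Set} (ls : List A) {c rs a b} →
  length (ls ++ c ∷ rs) ≡ suc (a + b) → length ls ≡ a → length rs ≡ b
pivot-length ls {c} {rs} {a} {b} |l| refl =
  +-cancelˡ-≡ a _ _ (suc-injective (trans (sym (+-suc a _)) (trans (sym (length-++ ls)) |l|)))

negsuc-balance : ∀ m {a l} → ℤ.-[1+ m ] ℤ.+ + a ≡ + l → a ≡ l + suc m
negsuc-balance m {a} {l} eq = ℤp.+-injective (begin
  + a                                     ≡⟨ ℤp.+-identityʳ (+ a) ⟨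
  + a ℤ.+ 0ℤ                              ≡⟨ cong (λ d → + a ℤ.+ d) (ℤp.+-inverseˡ (+ suc m)) ⟨
  + a ℤ.+ (ℤ.-[1+ m ] ℤ.+ + suc m)        ≡⟨ ℤp.+-assoc (+ a) ℤ.-[1+ m ] (+ suc m) ⟨
  (+ a ℤ.+ ℤ.-[1+ m ]) ℤ.+ + suc m        ≡⟨ cong (λ d → d ℤ.+ + suc m) (ℤp.+-comm (+ a) ℤ.-[1+ m ]) ⟩
  (ℤ.-[1+ m ] ℤ.+ + a) ℤ.+ + suc m        ≡⟨ cong (λ d → d ℤ.+ + suc m) eq ⟩
  + (l + suc m)                           ∎)
  where open ≡-Reasoning

minus-plus : ∀ z d → (z ℤ.- + d) ℤ.+ + d ≡ z
minus-plus z d = trans (ℤp.+-assoc z (ℤ.- + d) (+ d))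
  (trans (cong (λ e → z ℤ.+ e) (ℤp.+-inverseˡ (+ d))) (ℤp.+-identityʳ z))

-- The `suc k` prefixes arriving from the waiting list precede the exchanged one and raise its
-- position by `suc k`. Conservation turns this into the rule that adds `b`, the next value on `y`,
-- to a negative offset.
offset-advance : ∀ z {a} a′ b {k l} → z ℤ.+ + a ≡ + l → suc (k + a) ≡ a′ + b →
  (z ℤ.+ + b) ℤ.+ + a′ ≡ + (suc k + l)
offset-advance z {a} a′ b {k} {l} eq cons = begin
  (z ℤ.+ + b) ℤ.+ + a′        ≡⟨ ℤp.+-assoc z (+ b) (+ a′) ⟩
  z ℤ.+ + (b + a′)            ≡⟨ cong (λ d → z ℤ.+ + d) (trans (+-comm b a′) (sym cons)) ⟩
  z ℤ.+ + (suc k + a)         ≡⟨ cong (λ d → z ℤ.+ + d) (+-comm (suc k) a) ⟩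
  z ℤ.+ (+ a ℤ.+ + suc k)     ≡⟨ ℤp.+-assoc z (+ a) (+ suc k) ⟨
  (z ℤ.+ + a) ℤ.+ + suc k     ≡⟨ cong (λ d → d ℤ.+ + suc k) eq ⟩
  + (l + suc k)               ≡⟨ cong +_ (+-comm l (suc k)) ⟩
  + (suc k + l)               ∎
  where open ≡-Reasoning

-- Propagation of a single exchanged prefix.

module Compare {n : ℕ} {φ φ′ : Flow n} (flow : IsIntegerFlow φ)
  {C C′ : RouteSet n} (clique : IsClique C) (clique′ : IsClique C′)
  (counts : Counts C φ) (counts′ : Counts C′ φ′) where

  -- The equivalence in decided form, so that each branch of the offset recursion settles both sides
  -- at once.
  Outcome : ∀ {k} → Vec (Maybe ℤ) k → Set
  Outcome zs = (Adjacent C C′ × just 0ℤ ∉ zs) ⊎ (¬ Adjacent C C′ × just 0ℤ ∈ᵛ zs)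

  outcome-∷ : ∀ {k o} {zs : Vec (Maybe ℤ) k} → o ≢ just 0ℤ → Outcome zs → Outcome (o ∷ zs)
  outcome-∷ o≢0 (inj₁ (adj , 0∉)) = inj₁ (adj , λ { (hereᵛ e) → o≢0 (sym e) ; (thereᵛ m) → 0∉ m })
  outcome-∷ o≢0 (inj₂ (¬adj , 0∈)) = inj₂ (¬adj , thereᵛ 0∈)

  Agree : ℕ → Set
  Agree t = ∀ j → 2 + t ≤ j →
    (∀ .{p q} → φ′ (x j p q) ≡ φ (x j p q)) × (∀ .{p} → φ′ (y j p) ≡ φ (y j p))

  agree-suc : ∀ {t} → Agree t → Agree (suc t)
  agree-suc ag j le = ag j (<⇒≤ le)

  module _ {t : ℕ} (lt : 2 + t < n) where
    a b : ℕ
    a = φ (x (2 + t) z<s lt)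
    b = φ (y (2 + t) lt)

    Lengths : List (EdgeSeq n) → List (EdgeSeq n) → Set
    Lengths K L = length K ≡ suc (φ (y (1 + t) (<⇒≤ lt))) × length L ≡ suc (a + b)

  lengths-step : ∀ {t} (lt : 2 + t < n) (lt′ : 3 + t < n) K A B {c} →
    length K ≡ suc (φ (y (1 + t) (<⇒≤ lt))) → length A ≡ a lt → length B ≡ b lt →
    Lengths lt′ (c ∷ B) (map (_∷ʳ y (1 + t) (<⇒≤ lt)) K ++ map (_∷ʳ x (2 + t) z<s lt) (A ∷ʳ c))
  lengths-step lt lt′ K A B |K| |A| |B| =
    cong suc |B| , trans (length-step _ _ K A |K| |A|) (cong suc (conservation flow lt′))

  -- At v = 2 + t the prefix T of C is replaced by T′ in C′; the offset z is the
  -- distance from the prefix followed by both x v and y v to T.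
  record Exchange (t : ℕ) (lt : 2 + t < n) (z : ℤ) : Set where
    field
      {K L M} : List (EdgeSeq n)
      {T T′}  : EdgeSeq n
      state   : State C t lt K (L ++ T ∷ M)
      state′  : State C′ t lt K (L ++ T′ ∷ M)
      T∉      : ¬ Pre C′ (2 + t) T
      T′∉     : ¬ Pre C (2 + t) T′
      lengths : Lengths lt K (L ++ T ∷ M)
      offset  : z ℤ.+ + a lt ≡ + length L

  -- The same for a prefix followed by y (v-1), when all prefixes at v agree.
  record Exchangeᴷ (t : ℕ) (lt : 2 + t < n) (z : ℕ) : Set where
    field
      {K L M} : List (EdgeSeq n)
      {T T′}  : EdgeSeq n
      state   : State C t lt (K ++ T ∷ M) L
      state′  : State C′ t lt (K ++ T′ ∷ M) L
      T∉      : ¬ PrefixBefore C′ (y (1 + t) (<⇒≤ lt)) T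
      T′∉     : ¬ PrefixBefore C (y (1 + t) (<⇒≤ lt)) T′
      lengths : Lengths lt (K ++ T ∷ M) L
      offset  : z ≡ length K

  -- If `2 + t` is the last inner vertex, the difference becomes an exchange of routes. Otherwise
  -- the situation `X` holds at the next vertex.
  Continues : (t : ℕ) → (3 + t < n → Set) → Set
  Continues t X = (3 + t ≡ n → Adjacent C C′) × (∀ lt′ → X lt′)

  lost : ∀ {D : RouteSet n} {e P} → IsClique D → ¬ PrefixBefore D e P → (P ∷ʳ e) ∉ˡ D
  lost clq ¬b m = ¬b (proj₁ (pre-∷ʳ⇒before (∈⇒pre-end clq m)))

  module _ {t : ℕ} {lt : 2 + t < n} where

    module Pivot {K K′ A A′ B B′ c c′}
      (st : State C t lt K (A ++ c ∷ B)) (st′ : State C′ t lt K′ (A′ ++ c′ ∷ B′))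
      (|A| : length A ≡ φ (x (2 + t) z<s lt)) (|B| : length B ≡ φ (y (2 + t) lt))
      (|A′| : length A′ ≡ φ′ (x (2 + t) z<s lt)) (|B′| : length B′ ≡ φ′ (y (2 + t) lt)) where

      next  = advance clique counts lt st |A| |B|
      next′ = advance clique′ counts′ lt st′ |A′| |B′|

      out  = step-K clique counts lt st |A| |B|
        ++ step-X clique counts lt st |A| |B| ++ step-Y clique counts lt st |A| |B|
      out′ = step-K clique′ counts′ lt st′ |A′| |B′|
        ++ step-X clique′ counts′ lt st′ |A′| |B′| ++ step-Y clique′ counts′ lt st′ |A′| |B′|

      final : ∀ {D T T′} → 3 + t ≡ n → T ∉ˡ C′ → T′ ∉ˡ C →
        out ↭ T ∷ D → out′ ↭ T′ ∷ D → Adjacent C C′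
      final end T∉ T′∉ σ σ′ = adjacent-replace
        (finish clique counts lt st |A| |B| end) (finish clique′ counts′ lt st′ |A′| |B′| end) σ σ′ T∉ T′∉

  module _ {t : ℕ} {lt : 2 + t < n} (agree : Agree t) where
    private
      φx : φ (x (2 + t) z<s lt) ≡ φ′ (x (2 + t) z<s lt)
      φx = sym (proj₁ (agree (2 + t) ≤-refl))
      φy : φ (y (2 + t) lt) ≡ φ′ (y (2 + t) lt)
      φy = sym (proj₂ (agree (2 + t) ≤-refl))

    -- The pivot `c` lies in `M`, beyond the exchanged prefixes, which are therefore followed by
    -- `x (2 + t)` only.
    exchange-neg : ∀ {m} → Exchange t lt ℤ.-[1+ m ] →
      Continues t λ lt′ → Exchange (suc t) lt′ (ℤ.-[1+ m ] ℤ.+ + b lt′)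
    exchange-neg {m} record { K = K ; L = L ; M = M ; T = T ; T′ = T′ ; state = st ; state′ = st′
                            ; T∉ = T∉ ; T′∉ = T′∉ ; lengths = |K| , |L| ; offset = off }
      with splitAt-length m M (pivot-length L (trans |L| (cong suc
        (trans (cong (_+ b lt) (negsuc-balance m off)) (+-assoc (length L) (suc m) (b lt))))) refl)
    ... | E , c , B , refl , |E| , |B| =
      (λ end → P.final end (lost clique′ (T∉ ∘ before⇒pre)) (lost clique (T′∉ ∘ before⇒pre))
        (step-x-↭ f g K L E) (step-x-↭ f g K L E)) ,
      λ lt′ → record
        { state   = subst (State C (suc t) lt′ (c ∷ B)) (step-x-shape f g K L E) (P.next lt′)
        ; state′  = subst (State C′ (suc t) lt′ (c ∷ B)) (step-x-shape f g K L E) (P.next′ lt′)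
        ; T∉      = T∉ ∘ before⇒pre ∘ proj₁ ∘ pre-∷ʳ⇒before
        ; T′∉     = T′∉ ∘ before⇒pre ∘ proj₁ ∘ pre-∷ʳ⇒before
        ; lengths = subst (Lengths lt′ (c ∷ B)) (step-x-shape f g K L E)
            (lengths-step lt lt′ K (L ++ T ∷ E) B |K| |A| |B|)
        ; offset  = trans
            (offset-advance ℤ.-[1+ m ] (a lt′) (b lt′) off (conservation flow lt′))
            (cong +_ (sym (trans (length-++ (map f K))
              (cong₂ _+_ (trans (length-map f K) |K|) (length-map g L)))))
        }
      where
      f g : EdgeSeq n → EdgeSeq n
      f = _∷ʳ y (1 + t) (<⇒≤ lt)
      g = _∷ʳ x (2 + t) z<s lt
      length-A : ∀ U → length (L ++ U ∷ E) ≡ a lt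
      length-A U = trans (length-++ L) (trans (cong (λ k → length L + suc k) |E|) (sym (negsuc-balance m off)))
      |A| : length (L ++ T ∷ E) ≡ a lt
      |A| = length-A T
      module P = Pivot {lt = lt} {A = L ++ T ∷ E} {L ++ T′ ∷ E} {B} {B} {c} {c}
        (subst (State C t lt K) (sym (++-assoc L (T ∷ E) (c ∷ B))) st)
        (subst (State C′ t lt K) (sym (++-assoc L (T′ ∷ E) (c ∷ B))) st′)
        |A| |B| (trans (length-A T′) φx) (trans |B| φy)

    -- Here `T` is itself the pivot. Routes through `T` along both outgoing edges exist in `C`, and
    -- both are lost since `T` is no prefix of `C′`.
    exchange-zero : Exchange t lt 0ℤ → ¬ Adjacent C C′
    exchange-zero ex with Equivalence.from bx (∈-++⁺ʳ L (here refl)) | Equivalence.from by (here refl)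
      where
      open Exchange ex
      |A| : length L ≡ a lt
      |A| = sym (ℤp.+-injective offset)
      |B| = pivot-length L (proj₂ lengths) |A|
      bx = before-x clique counts lt state |A| |B|
      by = before-y clique counts lt state |A| |B|
    ... | p , s , m | _ , s′ , m′ =
      two-lost⇒¬adjacent (λ e → x≢y (proj₁ (∷-injective (++-cancelˡ (Exchange.T ex) _ _ e))))
        m (gone p) m′ (gone p)
      where
      x≢y : ∀ {i j} .{p q r} → _≢_ {A = Edge n} (x i p q) (y j r)
      x≢y ()
      gone : ∀ {s} → IsPath 1 (Exchange.T ex) (2 + t) → Exchange.T ex ++ s ∉ˡ C′
      gone p m = Exchange.T∉ ex (p , _ , m)

    -- The pivot lies in `L`, so the exchanged prefixes are followed by `y (2 + t)` only and skip
    -- `3 + t`, where the offset is `nothing`. Their position in the waiting list, after `c ∷ E`, is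
    -- again `suc m`.
    exchange-pos : ∀ {m} → Exchange t lt (+ suc m) →
      Continues t λ lt′ → Exchangeᴷ (suc t) lt′ (suc m)
    exchange-pos {m} record { K = K ; L = L ; M = M ; T = T ; T′ = T′ ; state = st ; state′ = st′
                            ; T∉ = T∉ ; T′∉ = T′∉ ; lengths = |K| , |L| ; offset = off }
      with splitAt-length (a lt) L (trans (sym (ℤp.+-injective off)) (cong suc (+-comm m (a lt))))
    ... | A , c , E , refl , |A| , |E| =
      (λ end → P.final end (lost clique′ (T∉ ∘ before⇒pre)) (lost clique (T′∉ ∘ before⇒pre))
        (step-y-↭ _ (map f K) (map g (A ∷ʳ c)) (c ∷ E) M)
        (step-y-↭ _ (map f K) (map g (A ∷ʳ c)) (c ∷ E) M)) ,
      λ lt′ → record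
        { K       = c ∷ E
        ; state   = P.next lt′
        ; state′  = P.next′ lt′
        ; T∉      = T∉ ∘ before⇒pre
        ; T′∉     = T′∉ ∘ before⇒pre
        ; lengths = lengths-step lt lt′ K A (E ++ T ∷ M) |K| |A| |B|
        ; offset  = cong suc (sym |E|)
        }
      where
      f g : EdgeSeq n → EdgeSeq n
      f = _∷ʳ y (1 + t) (<⇒≤ lt)
      g = _∷ʳ x (2 + t) z<s lt
      length-B : ∀ (U V : EdgeSeq n) → length (E ++ U ∷ M) ≡ length (E ++ V ∷ M)
      length-B U V = trans (length-++ E) (sym (length-++ E))
      |B| : length (E ++ T ∷ M) ≡ b lt
      |B| = pivot-length A (subst (λ l → length l ≡ suc (a lt + b lt)) (++-assoc A (c ∷ E) (T ∷ M)) |L|) |A|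
      module P = Pivot {lt = lt} {A = A} {A} {E ++ T ∷ M} {E ++ T′ ∷ M} {c} {c}
        (subst (State C t lt K) (++-assoc A (c ∷ E) (T ∷ M)) st)
        (subst (State C′ t lt K) (++-assoc A (c ∷ E) (T′ ∷ M)) st′)
        |A| |B| (trans |A| φx) (trans (length-B T′ T) (trans |B| φy))

    -- Prefixes from the waiting list come first at the next vertex, so the position `z` persists.
    -- Subtracting `a lt′` makes it relative to the new pivot.
    exchangeᴷ : ∀ {z} → Exchangeᴷ t lt z →
      Continues t λ lt′ → Exchange (suc t) lt′ (+ z ℤ.- + a lt′)
    exchangeᴷ record { K = K ; L = L ; M = M ; T = T ; state = st ; state′ = st′
                     ; T∉ = T∉ ; T′∉ = T′∉ ; lengths = |K| , |L| ; offset = refl }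
      with splitAt-length (a lt) L |L|
    ... | A , c , B , refl , |A| , |B| =
      (λ end → P.final end (lost clique′ T∉) (lost clique T′∉)
        (↭-trans (↭-reflexive (step-y-shape f K)) (shift _ (map f K) _))
        (↭-trans (↭-reflexive (step-y-shape f K)) (shift _ (map f K) _))) ,
      λ lt′ → record
        { state   = subst (State C (suc t) lt′ (c ∷ B)) (step-y-shape f K) (P.next lt′)
        ; state′  = subst (State C′ (suc t) lt′ (c ∷ B)) (step-y-shape f K) (P.next′ lt′)
        ; T∉      = T∉ ∘ proj₁ ∘ pre-∷ʳ⇒before
        ; T′∉     = T′∉ ∘ proj₁ ∘ pre-∷ʳ⇒before
        ; lengths = subst (Lengths lt′ (c ∷ B)) (step-y-shape f K {M = M})
            (lengths-step lt lt′ (K ++ T ∷ M) A B |K| |A| |B|)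
        ; offset  = trans (minus-plus (+ length K) (a lt′)) (cong +_ (sym (length-map f K)))
        }
      where
      f : EdgeSeq n → EdgeSeq n
      f = _∷ʳ y (1 + t) (<⇒≤ lt)
      module P = Pivot {lt = lt} {A = A} {A} {B} {B} {c} {c} st st′ |A| |B| (trans |A| φx) (trans |B| φy)

  -- The recursion follows `offsetsFrom`: a negative offset advances by one vertex, a positive one
  -- by two, and a zero ends it.
  exchange-outcome : ∀ k {t} (lt : 2 + t < n) → 3 + t + k ≡ n → .(bound : 2 + t + k < n) → Agree t →
    ∀ z → Exchange t lt z → Outcome (offsetsFrom φ k (2 + t) bound z)
  exchange-outcome zero {t} lt end bound ag ℤ.-[1+ m ] ex =
    inj₁ (proj₁ (exchange-neg ag ex) (trans (sym (+-identityʳ (3 + t))) end) , λ { (hereᵛ ()) ; (thereᵛ ()) })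
  exchange-outcome zero lt end bound ag (+ zero) ex =
    inj₂ (exchange-zero ag ex , hereᵛ refl)
  exchange-outcome zero {t} lt end bound ag (+ suc m) ex =
    inj₁ (proj₁ (exchange-pos ag ex) (trans (sym (+-identityʳ (3 + t))) end) , λ { (hereᵛ ()) ; (thereᵛ ()) })
  exchange-outcome (suc k) {t} lt end bound ag ℤ.-[1+ m ] ex =
    outcome-∷ (λ ()) (exchange-outcome k lt′ end′ _ (agree-suc ag) _ (proj₂ (exchange-neg ag ex) lt′))
    where
    end′ : 4 + t + k ≡ n
    end′ = trans (sym (+-suc (3 + t) k)) end
    lt′ : 3 + t < n
    lt′ = subst (3 + t <_) end′ (m≤m+n (4 + t) k)
  exchange-outcome (suc k) lt end bound ag (+ zero) ex =
    inj₂ (exchange-zero ag ex , hereᵛ refl)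
  -- Here `2 + t = n - 2`, so the exchanged prefixes reach the sink directly by `y (2 + t)`.
  exchange-outcome (suc zero) {t} lt end bound ag (+ suc m) ex =
    inj₁ (proj₁ (exchangeᴷ (agree-suc ag) (proj₂ (exchange-pos ag ex) lt′)) end′
         , λ { (hereᵛ ()) ; (thereᵛ (hereᵛ ())) ; (thereᵛ (thereᵛ ())) })
    where
    end′ : 4 + t ≡ n
    end′ = trans (+-comm 1 (3 + t)) end
    lt′ : 3 + t < n
    lt′ = ≤-reflexive end′
  exchange-outcome (suc (suc k)) {t} lt end bound ag (+ suc m) ex =
    outcome-∷ (λ ()) (outcome-∷ (λ ()) (exchange-outcome k lt″ end″ _ (agree-suc (agree-suc ag)) _
      (proj₂ (exchangeᴷ (agree-suc ag) (proj₂ (exchange-pos ag ex) (<⇒≤ lt″))) lt″)))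
    where
    end″ : 5 + t + k ≡ n
    end″ = trans (cong suc (sym (+-suc (3 + t) k))) (trans (sym (+-suc (3 + t) (suc k))) end)
    lt″ : 4 + t < n
    lt″ = subst (4 + t <_) end″ (m≤m+n (5 + t) k)

  -- How the move creates the exchange.

  record Same (t : ℕ) (lt : 2 + t < n) : Set where
    field
      {K L}   : List (EdgeSeq n)
      state   : State C t lt K L
      state′  : State C′ t lt K L
      lengths : Lengths lt K L

  -- Situation at v = i + 1: C has one more prefix T, ending in x i, and C′ has
  -- one more prefix U at i that is followed by y i.
  record Removal (t : ℕ) (lt : 2 + t < n) : Set where
    field
      {K L}   : List (EdgeSeq n)
      {T U}   : EdgeSeq n
      state   : State C t lt K (L ∷ʳ T)
      state′  : State C′ t lt (U ∷ K) L
      T∉      : ¬ Pre C′ (2 + t) T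
      U∉      : ¬ PrefixBefore C (y (1 + t) (<⇒≤ lt)) U
      lengths : Lengths lt K (L ∷ʳ T)

  -- Situation at v = i + 2: T is now followed by y (i+1), and U ends in y i.
  record Transfer (t : ℕ) (lt : 2 + t < n) (z : ℕ) : Set where
    field
      {K L}   : List (EdgeSeq n)
      {T U}   : EdgeSeq n
      state   : State C t lt (K ∷ʳ T) L
      state′  : State C′ t lt K (U ∷ L)
      T∉      : ¬ PrefixBefore C′ (y (1 + t) (<⇒≤ lt)) T
      U∉      : ¬ Pre C (2 + t) U
      lengths : Lengths lt (K ∷ʳ T) L
      offset  : z ≡ length K

  module _ {t : ℕ} {lt : 2 + t < n} where

    private
      f g h : EdgeSeq n → EdgeSeq n
      f = _∷ʳ y (1 + t) (<⇒≤ lt)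
      g = _∷ʳ x (2 + t) z<s lt
      h = _∷ʳ y (2 + t) lt

    same-step : φ′ (x (2 + t) z<s lt) ≡ φ (x (2 + t) z<s lt) → φ′ (y (2 + t) lt) ≡ φ (y (2 + t) lt) →
      Same t lt → ∀ lt′ → Same (suc t) lt′
    same-step φ′x φ′y record { K = K ; L = L ; state = st ; state′ = st′ ; lengths = |K| , |L| } lt′
      with splitAt-length (a lt) L |L|
    ... | A , c , B , refl , |A| , |B| = record
      { state   = P.next lt′
      ; state′  = P.next′ lt′
      ; lengths = lengths-step lt lt′ K A B |K| |A| |B|
      }
      where
      module P = Pivot {lt = lt} {A = A} {A} {B} {B} {c} {c} st st′ |A| |B|
        (trans |A| (sym φ′x)) (trans |B| (sym φ′y))

    -- At `i = 2 + t` the move shifts the pivot one place to the left, from `q` in `C` to `p` in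
    -- `C′`. Hence only `C` continues `q` by `x i`, and only `C′` continues `p` by `y i`.
    same-removal : ∀ {k} → φ (x (2 + t) z<s lt) ≡ suc k → φ′ (x (2 + t) z<s lt) ≡ k →
      φ′ (y (2 + t) lt) ≡ suc (φ (y (2 + t) lt)) →
      Same t lt → Continues t λ lt′ → Removal (suc t) lt′
    same-removal {k} φx φ′x φ′y record { K = K ; L = L ; state = st ; state′ = st′ ; lengths = |K| , |L| }
      with splitAt-length k L (trans |L| (cong suc (trans (cong (_+ b lt) φx) (sym (+-suc k (b lt))))))
    ... | A , p , q ∷ B , refl , |A| , |qB| =
      (λ end → P.final end (lost clique′ q∉) (lost clique p∉)
        (step-x-last-↭ g (map f K) (A ∷ʳ p))
        (↭-trans (↭-reflexive (sym (++-assoc (map f K) (map g (A ∷ʳ p)) _)))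
          (shift (h p) (map f K ++ map g (A ∷ʳ p)) (map h (q ∷ B))))) ,
      λ lt′ → record
        { L       = map f K ++ map g (A ∷ʳ p)
        ; state   = subst (State C (suc t) lt′ (q ∷ B)) last-out (P.next lt′)
        ; state′  = P.next′ lt′
        ; T∉      = q∉ ∘ proj₁ ∘ pre-∷ʳ⇒before
        ; U∉      = p∉
        ; lengths = subst (Lengths lt′ (q ∷ B)) last-out (lengths-step lt lt′ K (A ∷ʳ p) B |K| |Ap| |B|)
        }
      where
      last-out : map f K ++ map g ((A ∷ʳ p) ∷ʳ q) ≡ (map f K ++ map g (A ∷ʳ p)) ∷ʳ g q
      last-out = trans (cong (map f K ++_) (map-++ g (A ∷ʳ p) [ q ])) (sym (++-assoc (map f K) _ _))
      |Ap| : length (A ∷ʳ p) ≡ a lt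
      |Ap| = trans (length-++ A) (trans (+-comm (length A) 1) (trans (cong suc |A|) (sym φx)))
      |B| : length B ≡ b lt
      |B| = suc-injective |qB|
      st₁ : State C t lt K ((A ∷ʳ p) ++ q ∷ B)
      st₁ = subst (State C t lt K) (sym (++-assoc A [ p ] (q ∷ B))) st
      module P = Pivot {lt = lt} {A = A ∷ʳ p} {A} {B} {q ∷ B} {q} {p} st₁ st′
        |Ap| |B| (trans |A| (sym φ′x)) (trans |qB| (sym φ′y))
      -- A sorted list has no repetitions, so `q` is absent from `A ∷ʳ p`. The same argument
      -- excludes `p` from `q ∷ B` below.
      q∉ : ¬ PrefixBefore C′ (x (2 + t) z<s lt) q
      q∉ bq = sorted⇒∉ˡ (A ∷ʳ p) (State.L-sorted st₁)
        (Equivalence.to (before-x clique′ counts′ lt {A = A} st′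
          (trans |A| (sym φ′x)) (trans |qB| (sym φ′y))) bq)
      p∉ : ¬ PrefixBefore C (y (2 + t) lt) p
      p∉ bp = sorted⇒∉ʳ A (State.L-sorted st)
        (Equivalence.to (before-y clique counts lt {A = A ∷ʳ p} st₁ |Ap| |B|) bp)

    -- Since `T` comes last and `φ (y (2 + t))` is positive, the pivot lies in `L`. So `T` is
    -- followed by `y (2 + t)` only, and the drop of the flow there matches its absence from `C′`.
    removal-transfer : ∀ {k} → φ (y (2 + t) lt) ≡ suc k → φ′ (y (2 + t) lt) ≡ k →
      φ′ (x (2 + t) z<s lt) ≡ φ (x (2 + t) z<s lt) →
      Removal t lt → Continues t λ lt′ → Transfer (suc t) lt′ (suc k)
    removal-transfer {k} φy φ′y φ′x record { K = K ; L = L ; T = T ; U = U ; state = st ; state′ = st′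
                                           ; T∉ = T∉ ; U∉ = U∉ ; lengths = |K| , |L| }
      with splitAt-length (a lt) L (suc-injective (begin
        suc (length L)       ≡⟨ +-comm 1 (length L) ⟩
        length L + 1         ≡⟨ length-++ L ⟨
        length (L ∷ʳ T)      ≡⟨ |L| ⟩
        suc (a lt + b lt)    ≡⟨ cong (λ d → suc (a lt + d)) φy ⟩
        suc (a lt + suc k)   ≡⟨ cong suc (+-suc (a lt) k) ⟩
        suc (suc (a lt + k)) ∎))
      where open ≡-Reasoning
    ... | A , c , B , refl , |A| , |B| =
      (λ end → P.final end (lost clique′ (T∉ ∘ before⇒pre)) (lost clique U∉)
        (step-y-↭ h (map f K) (map g (A ∷ʳ c)) (c ∷ B) [])
        (prep (f U) (↭-reflexive (trans (sym (++-assoc (map f K) _ _)) (sym (++-identityʳ _)))))) ,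
      λ lt′ → record
        { K       = c ∷ B
        ; state   = P.next lt′
        ; state′  = P.next′ lt′
        ; T∉      = T∉ ∘ before⇒pre
        ; U∉      = U∉ ∘ proj₁ ∘ pre-∷ʳ⇒before
        ; lengths = lengths-step lt lt′ K A (B ∷ʳ T) |K| |A| |BT|
        ; offset  = cong suc (sym |B|)
        }
      where
      |BT| : length (B ∷ʳ T) ≡ b lt
      |BT| = trans (length-++ B) (trans (+-comm (length B) 1) (trans (cong suc |B|) (sym φy)))
      module P = Pivot {lt = lt} {A = A} {A} {B ∷ʳ T} {B} {c} {c}
        (subst (State C t lt K) (++-assoc A (c ∷ B) [ T ]) st) st′
        |A| |BT| (trans |A| (sym φ′x)) (trans |B| (sym φ′y))

    -- At `3 + t`, `T` is the last prefix of `C` arriving by `y (1 + t)` and `U` the first of `C′`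
    -- arriving by `x (2 + t)`. With the extra unit on `x (2 + t)` the pivot is common, so both
    -- occupy the same position.
    transfer-exchange : ∀ {z} → φ′ (x (2 + t) z<s lt) ≡ suc (φ (x (2 + t) z<s lt)) →
      φ′ (y (2 + t) lt) ≡ φ (y (2 + t) lt) →
      Transfer t lt z → Continues t λ lt′ → Exchange (suc t) lt′ (+ z ℤ.- + a lt′)
    transfer-exchange φ′x φ′y record { K = K ; L = L ; T = T ; U = U ; state = st ; state′ = st′
                                     ; T∉ = T∉ ; U∉ = U∉ ; lengths = |K| , |L| ; offset = refl }
      with splitAt-length (a lt) L |L|
    ... | A , c , B , refl , |A| , |B| =
      (λ end → P.final end (lost clique′ T∉) (lost clique (U∉ ∘ before⇒pre))
        (↭-trans (↭-reflexive (step-y-shape f K)) (shift (f T) (map f K) _))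
        (shift (g U) (map f K) _)) ,
      λ lt′ → record
        { state   = subst (State C (suc t) lt′ (c ∷ B)) (step-y-shape f K) (P.next lt′)
        ; state′  = P.next′ lt′
        ; T∉      = T∉ ∘ proj₁ ∘ pre-∷ʳ⇒before
        ; T′∉     = U∉ ∘ before⇒pre ∘ proj₁ ∘ pre-∷ʳ⇒before
        ; lengths = subst (Lengths lt′ (c ∷ B)) (step-y-shape f K {M = []})
            (lengths-step lt lt′ (K ∷ʳ T) A B |K| |A| |B|)
        ; offset  = trans (minus-plus (+ length K) (a lt′)) (cong +_ (sym (length-map f K)))
        }
      where
      module P = Pivot {lt = lt} {A = A} {U ∷ A} {B} {B} {c} {c} st st′ |A| |B|
        (trans (cong suc |A|) (sym φ′x)) (trans |B| (sym φ′y))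

-- Values of the moved flow, and the assembly of the cases.

module _ {n : ℕ} (i : ℕ) (φ : Flow n) where

  move-x-≢ : ∀ {j} .{p q} → j ≢ i → j ≢ 2 + i → move i φ (x j p q) ≡ φ (x j p q)
  move-x-≢ {j} ≢i ≢2+i rewrite dec-false (j ≟ i) ≢i | dec-false (j ≟ 2 + i) ≢2+i = refl

  move-x-i : ∀ .{p q} → move i φ (x i p q) ≡ pred (φ (x i p q))
  move-x-i rewrite dec-true (i ≟ i) refl = refl

  move-x-2+i : ∀ .{p q} → move i φ (x (2 + i) p q) ≡ suc (φ (x (2 + i) p q))
  move-x-2+i rewrite dec-false (2 + i ≟ i) (m+1+n≢n 1) | dec-true (i ≟ i) refl = refl

  move-y-≢ : ∀ {j} .{p} → j ≢ i → j ≢ 1 + i → move i φ (y j p) ≡ φ (y j p)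
  move-y-≢ {j} ≢i ≢1+i rewrite dec-false (j ≟ i) ≢i | dec-false (j ≟ 1 + i) ≢1+i = refl

  move-y-i : ∀ .{p} → move i φ (y i p) ≡ suc (φ (y i p))
  move-y-i rewrite dec-true (i ≟ i) refl = refl

  move-y-1+i : ∀ .{p} → move i φ (y (1 + i) p) ≡ pred (φ (y (1 + i) p))
  move-y-1+i rewrite dec-false (1 + i ≟ i) 1+n≢n | dec-true (i ≟ i) refl = refl

-- The recursion inside `offsets` runs over `n ∸ suc i`. Abstracting this number together with its
-- equation exposes `offsetsFrom`.
offsets-elim : ∀ {n} (φ : Flow n) i (i<n : i < n) (P : ∀ {k} → Vec (Maybe ℤ) k → Set) →
  (1 + i ≡ n → P []) →
  (∀ k → .(b : 1 + i + k < n) .(lt : 1 + i < n) → 2 + i + k ≡ n →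
    P (offsetsFrom φ k (1 + i) b (+ φ (y (1 + i) lt)))) →
  P (offsets φ i i<n)
offsets-elim {n} φ i i<n P base step with n ∸ suc i | m+[n∸m]≡n i<n
... | zero  | eq = base (trans (cong suc (sym (+-identityʳ i))) eq)
... | suc k | eq = step k _ _ (trans (sym (+-suc (suc i) k)) eq)

theorem7 : ∀ (n : ℕ) → 3 ≤ n → ∀ (i : ℕ) (i-inner : Inner n i)
    (φ : Flow n) → IsIntegerFlow φ → MoveDefined φ i i-inner →
    ∀ (C C′ : RouteSet n) → IsMaximalClique C → IsMaximalClique C′ →
    CorrespondsTo C φ → CorrespondsTo C′ (move i φ) →
    Adjacent C C′ ⇔ just 0ℤ ∉ offsets φ i (proj₂ i-inner)
theorem7 n 3≤n i@(suc (suc s)) (s≤s (s≤s z≤n) , i<n) φ flow (φx>0 , φy>0) C C′ max max′ corr corr′ =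
  outcome⇒⇔ (offsets-elim φ i i<n Outcome
    -- For `i = n - 1` the sequence is empty and the exchange of routes is complete at `i`.
    (λ end → inj₁ (proj₁ removal end , λ ()))
    λ k b lt end → after-removal k b (subst (1 + i <_) end (m≤m+n (2 + i) k)) end)
  where
  open Compare {φ′ = move i φ} flow (IsMaximalClique.isClique max) (IsMaximalClique.isClique max′)
    (CorrespondsTo.inner corr) (CorrespondsTo.inner corr′)

  outcome⇒⇔ : ∀ {k} {zs : Vec (Maybe ℤ) k} → Outcome zs → Adjacent C C′ ⇔ just 0ℤ ∉ zs
  outcome⇒⇔ (inj₁ (adj , 0∉))  = mk⇔ (λ _ → 0∉) (λ _ → adj)
  outcome⇒⇔ (inj₂ (¬adj , 0∈)) = mk⇔ (λ adj → contradiction adj ¬adj) (λ 0∉ → contradiction 0∈ 0∉)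

  same : ∀ t (lt : 2 + t < n) → t ≤ s → Same t lt
  same zero lt _ = record
    { state   = initial 3≤n max
    ; state′  = initial 3≤n max′
    -- The edges `y 0`, `x 1` and `y 1` leave vertex 1, so `φ` vanishes on them. This gives one
    -- waiting prefix and two prefixes at vertex 2.
    ; lengths = cong suc (sym (CorrespondsTo.at-1 corr _ refl)) , cong suc (trans
        (cong suc (sym (cong₂ _+_ (CorrespondsTo.at-1 corr _ refl) (CorrespondsTo.at-1 corr _ refl))))
        (conservation flow lt))
    }
  same (suc t) lt t<s = same-step
    (move-x-≢ i φ (<⇒≢ t<i) (<⇒≢ (≤-trans t<i (m≤n+m i 2))))
    (move-y-≢ i φ (<⇒≢ t<i) (<⇒≢ (≤-trans t<i (n≤1+n i))))
    (same t (<⇒≤ lt) (<⇒≤ t<s)) lt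
    where
    t<i : 2 + t < i
    t<i = s≤s (s≤s t<s)

  removal : Continues s (Removal (suc s))
  removal = same-removal (sym (suc-pred _ {{>-nonZero φx>0}}))
    (move-x-i i φ) (move-y-i i φ) (same s i<n ≤-refl)

  transfer : ∀ lt → Continues (1 + s) λ lt′ → Transfer (2 + s) lt′ (φ (y (1 + i) lt))
  transfer lt = subst (λ k → Continues (1 + s) λ lt′ → Transfer (2 + s) lt′ k) suc-pred-y
    (removal-transfer (sym suc-pred-y) (move-y-1+i i φ)
      (move-x-≢ i φ 1+n≢n (<⇒≢ ≤-refl)) (proj₂ removal lt))
    where
    suc-pred-y : suc (pred (φ (y (1 + i) lt))) ≡ φ (y (1 + i) lt)
    suc-pred-y = suc-pred _ {{>-nonZero (φy>0 lt)}}

  exchange : ∀ lt lt′ → Continues (2 + s) λ lt″ →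
    Exchange (3 + s) lt″ (+ φ (y (1 + i) lt) ℤ.- + φ (x (3 + i) z<s lt″))
  exchange lt lt′ = transfer-exchange (move-x-2+i i φ)
    (move-y-≢ i φ (m+1+n≢n 1) 1+n≢n) (proj₂ (transfer lt) lt′)

  agree : Agree (3 + s)
  agree j le = move-x-≢ i φ (>⇒≢ (≤-trans (m≤n+m (1 + i) 2) le)) (>⇒≢ le)
             , move-y-≢ i φ (>⇒≢ (≤-trans (m≤n+m (1 + i) 2) le)) (>⇒≢ (≤-trans (n≤1+n (2 + i)) le))

  after-removal : ∀ k → .(b : 1 + i + k < n) (lt : 1 + i < n) → 2 + i + k ≡ n →
    Outcome (offsetsFrom φ k (1 + i) b (+ φ (y (1 + i) lt)))
  -- The first offset is `φ (y (1 + i))`, positive because the move is defined. The next entry is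
  -- therefore `nothing`, and the exchange starts at `3 + i`.
  after-removal k b lt end with φ (y (1 + i) lt) | φy>0 lt | transfer lt | exchange lt
  after-removal zero b lt end | suc z | _ | tr | _ =
    inj₁ (proj₁ tr (trans (sym (+-identityʳ (2 + i))) end) , λ { (hereᵛ ()) ; (thereᵛ ()) })
  after-removal (suc zero) b lt end | suc z | _ | _ | ex =
    inj₁ (proj₁ (ex (≤-reflexive end′)) end′ , λ { (hereᵛ ()) ; (thereᵛ (hereᵛ ())) ; (thereᵛ (thereᵛ ())) })
    where
    end′ : 3 + i ≡ n
    end′ = trans (+-comm 1 (2 + i)) end
  after-removal (suc (suc k)) b lt end | suc z | _ | _ | ex =
    outcome-∷ (λ ()) (outcome-∷ (λ ()) (exchange-outcome k lt″ end″ _ agree _ (proj₂ (ex (<⇒≤ lt″)) lt″)))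
    where
    end″ : 4 + i + k ≡ n
    end″ = trans (cong suc (sym (+-suc (2 + i) k))) (trans (sym (+-suc (2 + i) (suc k))) end)
    lt″ : 3 + i < n
    lt″ = subst (3 + i <_) end″ (m≤m+n (4 + i) k)
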